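{- Let $n\ge2$ and let $w$ be a fully commutative element of $W(B_n)$. Then $w$ is non-cancellable (in $W(B_n)$) if and only if $w$ is equal to either a product of commuting generators, $s_1s_2u$, or $s_2s_1u$, where $u$ is a product of commuting generators with $s_1,s_2,s_3\notin\mathrm{supp}(u)$. Analogously, a fully commutative element $w$ of $W(B'_n)$ is non-cancellable (in $W(B'_n)$) if and only if $w$ is equal to either a product of commuting generators, $s_{n+1}s_nu$, or $s_ns_{n+1}u$, where $u$ is a product of commuting generators with $s_{n+1},s_n,s_{n-1}\notin\mathrm{supp}(u)$.
   Context: $W(B_n)$ is the Coxeter group with generators $s_1,\dots,s_n$, $m(s_1,s_2)=4$, $m(s_i,s_{i+1})=3$ for $2\le i<n$, and $m(s_i,s_j)=2$ for $|i-j|\ge2$. $W(B'_n)$ is the Coxeter group with generators $s_2,\dots,s_{n+1}$, $m(s_n,s_{n+1})=4$, $m(s_i,s_{i+1})=3$ for $2\le i<n$, $m(s_i,s_j)=2$ for $|i-j|\ge2$. $\ell$ is length, $\mathcal{L}(w)$, $\mathcal{R}(w)$ the left/right descent sets, $\mathrm{supp}(w)$ the set of generators appearing in a reduced expression of $w$. An element is fully commutative if any two of its reduced expressions are related by moves $st\mapsto ts$ with $m(s,t)=2$. A fully commutative $w$ is left weak star reducible by $s$ with respect to $t$ if $m(s,t)\ge3$, $s\in\mathcal{L}(w)$, $t\in\mathcal{L}(sw)$, and $tw$ is not fully commutative; right weak star reducible is defined symmetrically with right descent sets and $wt$. A fully commutative element is non-cancellable if it is neither left nor right weak star reducible by any $s$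 with respect to any $t$. -}

module Defs where

open import Data.Nat using (ℕ; zero; suc; _+_; _≤_; _<_; _≡ᵇ_; ∣_-_∣)
open import Data.Bool using (Bool; true; false; if_then_else_; _∧_; _∨_)
open import Data.List using (List; []; _∷_; _++_; [_]; length)
open import Data.List.Relation.Unary.All using (All)
open import Data.List.Relation.Unary.AllPairs using (AllPairs)
open import Data.List.Membership.Propositional using (_∈_)
open import Data.Product using (Σ; _×_; ∃; ∃₂)
open import Data.Sum using (_⊎_)
open import Relation.Nullary using (¬_)
open import Relation.Binary.PropositionalEquality using (_≡_)

-- A Coxeter system on generators s_lo, ..., s_hi (indexed by naturals),
-- with Coxeter matrix entries m i j (all finite here).
record CoxSys : Set where
  field
    lo hi : ℕ
    m     : ℕ → ℕ → ℕ

module _ (C : CoxSys) where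
  open CoxSys C

  Gen : ℕ → Set
  Gen s = lo ≤ s × s ≤ hi

  Word : List ℕ → Set
  Word = All Gen

  alt : ℕ → ℕ → ℕ → List ℕ
  alt s t zero    = []
  alt s t (suc k) = s ∷ alt t s k

  -- Equality of group elements represented by words: the congruence on words
  -- generated by the Coxeter relations  s s = 1  and  (s t s ...)_{m(s,t)} = (t s t ...)_{m(s,t)}.
  -- (This is exactly the presentation of the Coxeter group.)
  data _≈_ : List ℕ → List ℕ → Set where
    ≈-refl   : ∀ {u} → u ≈ u
    ≈-sym    : ∀ {u v} → u ≈ v → v ≈ u
    ≈-trans  : ∀ {u v w} → u ≈ v → v ≈ w → u ≈ w
    ≈-cancel : ∀ {s} u v → Gen s → (u ++ s ∷ s ∷ v) ≈ (u ++ v)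
    ≈-braid  : ∀ {s t} u v → Gen s → Gen t →
               (u ++ alt s t (m s t) ++ v) ≈ (u ++ alt t s (m s t) ++ v)

  data _≈c_ : List ℕ → List ℕ → Set where
    c-refl  : ∀ {u} → u ≈c u
    c-sym   : ∀ {u v} → u ≈c v → v ≈c u
    c-trans : ∀ {u v w} → u ≈c v → v ≈c w → u ≈c w
    c-swap  : ∀ {s t} u v → m s t ≡ 2 → (u ++ s ∷ t ∷ v) ≈c (u ++ t ∷ s ∷ v)

  Reduced : List ℕ → Set
  Reduced w = ∀ v → Word v → v ≈ w → length w ≤ length v

  HasLength : List ℕ → ℕ → Set
  HasLength w k = Σ (List ℕ) λ v → Word v × v ≈ w × Reduced v × length v ≡ k

  LeftDescent : ℕ → List ℕ → Set
  LeftDescent s w = ∃₂ λ k k' → HasLength (s ∷ w) k × HasLength w k' × k < k'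

  RightDescent : ℕ → List ℕ → Set
  RightDescent s w = ∃₂ λ k k' → HasLength (w ++ [ s ]) k × HasLength w k' × k < k'

  InSupp : ℕ → List ℕ → Set
  InSupp s w = Σ (List ℕ) λ v → Word v × v ≈ w × Reduced v × s ∈ v

  FullyCommutative : List ℕ → Set
  FullyCommutative w = ∀ a b → Word a → Word b → a ≈ w → b ≈ w →
                       Reduced a → Reduced b → a ≈c b

  LeftWeakStarReducible : ℕ → ℕ → List ℕ → Set
  LeftWeakStarReducible s t w =
    Gen s × Gen t × 3 ≤ m s t × LeftDescent s w × LeftDescent t (s ∷ w)
    × ¬ FullyCommutative (t ∷ w)

  RightWeakStarReducible : ℕ → ℕ → List ℕ → Set
  RightWeakStarReducible s t w =
    Gen s × Gen t × 3 ≤ m s t × RightDescent s w × RightDescent t (w ++ [ s ])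
    × ¬ FullyCommutative (w ++ [ t ])

  NonCancellable : List ℕ → Set
  NonCancellable w = FullyCommutative w ×
    (∀ s t → ¬ LeftWeakStarReducible s t w × ¬ RightWeakStarReducible s t w)

  -- a word that is a product of pairwise commuting generators
  -- (pairwise m = 2, which in particular forces distinct letters)
  CommProd : List ℕ → Set
  CommProd u = Word u × AllPairs (λ a b → m a b ≡ 2) u

mB : ℕ → ℕ → ℕ
mB i j =
  if i ≡ᵇ j then 1
  else if ((i ≡ᵇ 1) ∧ (j ≡ᵇ 2)) ∨ ((i ≡ᵇ 2) ∧ (j ≡ᵇ 1)) then 4
  else if ∣ i - j ∣ ≡ᵇ 1 then 3
  else 2

mB' : ℕ → ℕ → ℕ → ℕ
mB' n i j =
  if i ≡ᵇ j then 1
  else if ((i ≡ᵇ n) ∧ (j ≡ᵇ suc n)) ∨ ((i ≡ᵇ suc n) ∧ (j ≡ᵇ n)) then 4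
  else if ∣ i - j ∣ ≡ᵇ 1 then 3
  else 2

WB : ℕ → CoxSys
WB n = record { lo = 1 ; hi = n ; m = mB }

WB' : ℕ → CoxSys
WB' n = record { lo = 2 ; hi = suc n ; m = mB' n }

{-# OPTIONS --safe #-}
-- Let a be a reduced word of a fully commutative w.  If w is not left weak star reducible, then no word
-- commutation equivalent to a starts with a braid s t s … of length m(s,t) − 1, m(s,t) ≥ 3: otherwise
-- t a is reduced (this only uses parity of length and full commutativity) and contains a long braid.
-- Hence in a the occurrences of i and i + 1 alternate, for every i ≥ 1.  If i ≥ 3 is maximal such that
-- i and i − 1 both occur, then i occurs once, and non-reducibility on both sides forces a zigzag from
-- i − 1 down to 1 2 1 at one end of a, which is excluded.  So the letters of a commute except possibly
-- 1 and 2, which leaves the three forms of the theorem.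
--
-- For the converse, and to find reduced words, words are normalised by a faithful action on codes of
-- signed permutations; descents can be read off the codes, which shows that u, 12u, 21u, 121u and 212u
-- are reduced and fully commutative.  The type B′ statement follows by relabelling i ↦ n + 2 − i.
module Submission where

open import Defs
open import Data.Bool using (Bool; true; false; not; _∧_; _∨_)
open import Data.Bool.Properties using (not-injective; not-involutive; ∨-comm)
open import Data.Empty using (⊥; ⊥-elim)
open import Data.List using (List; []; _∷_; _++_; [_]; length; filter; reverse; map; foldl; _∷ʳ_; initLast; _∷ʳ′_)
open import Data.List.Membership.Propositional using (_∈_; _∉_)
open import Data.List.Membership.Propositional.Properties using (∈-++⁺ˡ; ∈-++⁺ʳ; ∈-++⁻; ∈-∃++; ∈-map⁺)
open import Data.List.Properties
  using (++-assoc; ++-cancelˡ; ++-identityʳ; filter-++; filter-accept; filter-reject; foldl-++; length-++; length-map;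
         length-reverse; map-++; reverse-++; reverse-involutive; unfold-reverse; ∷-injectiveˡ)
open import Data.List.Relation.Binary.Permutation.Propositional using (_↭_; ↭-refl; ↭-sym; ↭-trans; ↭-swap)
import Data.List.Relation.Binary.Permutation.Propositional.Properties as Perm
open import Data.List.Relation.Unary.All as All using (All; []; _∷_)
import Data.List.Relation.Unary.All.Properties as All
open import Data.List.Relation.Unary.AllPairs as AllPairs using (AllPairs; []; _∷_)
open import Data.List.Relation.Unary.Any using (here; there)
import Data.List.Relation.Unary.Any.Properties as Any
open import Data.Nat using (ℕ; zero; suc; _+_; _∸_; _≤_; _<_; z≤n; s≤s; _≟_; ∣_-_∣; _≡ᵇ_)
open import Data.Nat.Properties
  using (1+n≢n; 1+n≰n; <-irrefl; _≤?_; m∸[m∸n]≡n; m∸n+n≡m; m∸n≤m; m≤m+n; m≤n+m; m≤n⇒m<n∨m≡n; m≤n⇒∣m-n∣≡n∸m;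
         m≤n⇒∣n-m∣≡n∸m; n∸n≡0; n≤1+n; suc-injective; ∸-cancelˡ-≡; ∸-monoʳ-≤; ≤-antisym; ≤-pred; ≤-refl; ≤-reflexive;
         ≤-trans; ≰⇒>; +-comm; +-identityʳ; +-monoˡ-≤; +-suc; +-∸-assoc)
open import Data.List.Membership.DecPropositional _≟_ using (_∈?_)
open import Data.Product using (Σ; _×_; _,_; proj₁; proj₂; ∃₂)
open import Data.Sum using (_⊎_; inj₁; inj₂)
open import Data.Unit using (⊤; tt)
open import Relation.Nullary using (¬_; Dec; yes; no)
open import Relation.Nullary.Decidable using (_⊎-dec_; dec-true; dec-false)
open import Relation.Binary.PropositionalEquality using (_≡_; _≢_; refl; sym; trans; cong; cong₂; subst; subst₂)

-- `Reduced` compares a word with every other word, so it cannot be checked letter by letter. The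
-- codes supply a length function: one letter lengthens the word of a code by at most one, so a word
-- leading from the identity to `x` has at least `length (word x)` letters. The alternation of
-- neighbours rests on two inductions in opposite directions. Two occurrences of i + 1 with no i
-- between them can be kept apart by i + 2 only, so that case descends from n. Two occurrences of i
-- with no i + 1 between them can be kept apart by i - 1 only, so that case ascends from 1, which
-- has a single neighbour. The obstacle is m(1,2) = 4: the factor 2 1 2 is no braid, and at the
-- letter 2 the ascending induction has to invoke the excluded starts.

parity : List ℕ → Bool
parity []      = false
parity (_ ∷ u) = not (parity u)

-- Words, congruence and commutation in an arbitrary Coxeter system.

module Coxeter (C : CoxSys) where
  open CoxSys C using (m) public

  infix 4 _∼_ _∼c_
  _∼_ _∼c_ : List ℕ → List ℕ → Set
  _∼_  = _≈_ C
  _∼c_ = _≈c_ C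

  ≡⇒∼ : ∀ {u v} → u ≡ v → u ∼ v
  ≡⇒∼ refl = ≈-refl

  ≡⇒∼c : ∀ {u v} → u ≡ v → u ∼c v
  ≡⇒∼c refl = c-refl

  ∼-∷ : ∀ s {u v} → u ∼ v → s ∷ u ∼ s ∷ v
  ∼-∷ s ≈-refl              = ≈-refl
  ∼-∷ s (≈-sym p)           = ≈-sym (∼-∷ s p)
  ∼-∷ s (≈-trans p q)       = ≈-trans (∼-∷ s p) (∼-∷ s q)
  ∼-∷ s (≈-cancel u v g)    = ≈-cancel (s ∷ u) v g
  ∼-∷ s (≈-braid u v g h)   = ≈-braid (s ∷ u) v g h

  ∼-++ˡ : ∀ x {u v} → u ∼ v → x ++ u ∼ x ++ v
  ∼-++ˡ []      p = p
  ∼-++ˡ (s ∷ x) p = ∼-∷ s (∼-++ˡ x p)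

  ∼-++ʳ : ∀ y {u v} → u ∼ v → u ++ y ∼ v ++ y
  ∼-++ʳ y ≈-refl           = ≈-refl
  ∼-++ʳ y (≈-sym p)        = ≈-sym (∼-++ʳ y p)
  ∼-++ʳ y (≈-trans p q)    = ≈-trans (∼-++ʳ y p) (∼-++ʳ y q)
  ∼-++ʳ y (≈-cancel {s} u v g) =
    subst₂ _∼_ (sym (++-assoc u (s ∷ s ∷ v) y)) (sym (++-assoc u v y)) (≈-cancel u (v ++ y) g)
  ∼-++ʳ y (≈-braid {s} {t} u v g h) =
    subst₂ _∼_ (assoc₃ (alt C s t (m s t))) (assoc₃ (alt C t s (m s t))) (≈-braid u (v ++ y) g h)
    where
    assoc₃ : ∀ a → u ++ a ++ v ++ y ≡ (u ++ a ++ v) ++ y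
    assoc₃ a = sym (trans (++-assoc u (a ++ v) y) (cong (u ++_) (++-assoc a v y)))

  ∼c-∷ : ∀ s {u v} → u ∼c v → s ∷ u ∼c s ∷ v
  ∼c-∷ s c-refl         = c-refl
  ∼c-∷ s (c-sym p)      = c-sym (∼c-∷ s p)
  ∼c-∷ s (c-trans p q)  = c-trans (∼c-∷ s p) (∼c-∷ s q)
  ∼c-∷ s (c-swap u v e) = c-swap (s ∷ u) v e

  ∼c-++ˡ : ∀ x {u v} → u ∼c v → x ++ u ∼c x ++ v
  ∼c-++ˡ []      p = p
  ∼c-++ˡ (s ∷ x) p = ∼c-∷ s (∼c-++ˡ x p)

  ∼c-++ʳ : ∀ y {u v} → u ∼c v → u ++ y ∼c v ++ y
  ∼c-++ʳ y c-refl         = c-refl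
  ∼c-++ʳ y (c-sym p)      = c-sym (∼c-++ʳ y p)
  ∼c-++ʳ y (c-trans p q)  = c-trans (∼c-++ʳ y p) (∼c-++ʳ y q)
  ∼c-++ʳ y (c-swap {s} {t} u v e) =
    subst₂ _∼c_ (sym (++-assoc u (s ∷ t ∷ v) y)) (sym (++-assoc u (t ∷ s ∷ v) y)) (c-swap u (v ++ y) e)

  ∼c-pass : ∀ {g u} z → All (λ x → m x g ≡ 2) u → u ++ g ∷ z ∼c g ∷ u ++ z
  ∼c-pass z []               = c-refl
  ∼c-pass z (_∷_ {x} {u} e es) = c-trans (∼c-∷ x (∼c-pass z es)) (c-swap [] (u ++ z) e)

  ∼c⇒↭ : ∀ {u v} → u ∼c v → u ↭ v
  ∼c⇒↭ c-refl         = ↭-refl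
  ∼c⇒↭ (c-sym p)      = ↭-sym (∼c⇒↭ p)
  ∼c⇒↭ (c-trans p q)  = ↭-trans (∼c⇒↭ p) (∼c⇒↭ q)
  ∼c⇒↭ (c-swap u v e) = Perm.++⁺ˡ u (↭-swap _ _ ↭-refl)

  ∼c-Word : ∀ {u v} → u ∼c v → Word C u → Word C v
  ∼c-Word p = Perm.All-resp-↭ (∼c⇒↭ p)

  -- `c-swap` exchanges letters without asking that they be generators, whereas `≈-braid` asks it.
  -- The hypothesis on `u` can be carried along because commutations only permute letters.
  ∼c⇒∼ : ∀ {u v} → Word C u → u ∼c v → u ∼ v
  ∼c⇒∼ w c-refl        = ≈-refl
  ∼c⇒∼ w (c-sym p)     = ≈-sym (∼c⇒∼ (∼c-Word (c-sym p) w) p)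
  ∼c⇒∼ w (c-trans p q) = ≈-trans (∼c⇒∼ w p) (∼c⇒∼ (∼c-Word p w) q)
  ∼c⇒∼ w (c-swap {s} {t} u v e) with All.++⁻ʳ u w
  ... | gs ∷ gt ∷ _ = subst₂ _∼_ (comm s t) (comm t s) (≈-braid u v gs gt)
    where
    comm : ∀ a b → u ++ alt C a b (m s t) ++ v ≡ u ++ a ∷ b ∷ v
    comm a b rewrite e = refl

  -- The sign character of the group, read on words.
  ∼-parity : ∀ {u v} → u ∼ v → parity u ≡ parity v
  ∼-parity ≈-refl        = refl
  ∼-parity (≈-sym p)     = sym (∼-parity p)
  ∼-parity (≈-trans p q) = trans (∼-parity p) (∼-parity q)
  ∼-parity (≈-cancel u v _) = go u
    where
    go : ∀ u {s} → parity (u ++ s ∷ s ∷ v) ≡ parity (u ++ v)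
    go []      = not-involutive (parity v)
    go (_ ∷ u) = cong not (go u)
  ∼-parity (≈-braid {s} {t} u v _ _) = go u
    where
    go′ : ∀ s t k → parity (alt C s t k ++ v) ≡ parity (alt C t s k ++ v)
    go′ s t zero    = refl
    go′ s t (suc k) = cong not (go′ t s k)
    go : ∀ u → parity (u ++ alt C s t (m s t) ++ v) ≡ parity (u ++ alt C t s (m s t) ++ v)
    go []      = go′ s t (m s t)
    go (_ ∷ u) = cong not (go u)

  length-alt : ∀ s t k → length (alt C s t k) ≡ k
  length-alt s t zero    = refl
  length-alt s t (suc k) = cong suc (length-alt t s k)

  reduced-≤ : ∀ {u v} → Reduced C u → u ∼ v → length v ≤ length u → Reduced C v
  reduced-≤ r p l x wx q = ≤-trans l (r x wx (≈-trans q (≈-sym p)))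

  reduced-tail : ∀ {s u} → Gen C s → Reduced C (s ∷ u) → Reduced C u
  reduced-tail gs r x wx q = ≤-pred (r _ (gs ∷ wx) (∼-∷ _ q))

  same-length : ∀ {u v} → Word C u → Word C v → Reduced C u → Reduced C v → u ∼ v → length u ≡ length v
  same-length wu wv ru rv p = ≤-antisym (ru _ wv (≈-sym p)) (rv _ wu p)

  FC-resp : ∀ {u v} → u ∼ v → FullyCommutative C u → FullyCommutative C v
  FC-resp p fc a b wa wb qa qb = fc a b wa wb (≈-trans qa (≈-sym p)) (≈-trans qb (≈-sym p))

  among? : ∀ s t x → Dec ((x ≡ s) ⊎ (x ≡ t))
  among? s t x = (x ≟ s) ⊎-dec (x ≟ t)

  -- Projection of a trace onto two letters. If the two do not commute, it is an invariant of the
  -- commutation class, and so a means of telling two classes apart.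
  restrict : ℕ → ℕ → List ℕ → List ℕ
  restrict s t = filter (among? s t)

  module _ {s t : ℕ} (s≢t : m s t ≢ 2) (t≢s : m t s ≢ 2) where
    private
      P? = among? s t

      swap-restrict : ∀ {a b} v → m a b ≡ 2 → restrict s t (a ∷ b ∷ v) ≡ restrict s t (b ∷ a ∷ v)
      swap-restrict {a} {b} v e with P? a | P? b
      ... | no a∉ | no b∉ = trans (filter-reject P? a∉) (trans (filter-reject P? b∉)
                              (sym (trans (filter-reject P? b∉) (filter-reject P? a∉))))
      ... | no a∉ | yes b∈ = trans (filter-reject P? a∉) (trans (filter-accept P? b∈)
                              (sym (trans (filter-accept P? b∈) (cong (b ∷_) (filter-reject P? a∉)))))
      ... | yes a∈ | no b∉ = trans (filter-accept P? a∈) (trans (cong (a ∷_) (filter-reject P? b∉))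
                              (sym (trans (filter-reject P? b∉) (filter-accept P? a∈))))
      ... | yes (inj₁ refl) | yes (inj₁ refl) = refl
      ... | yes (inj₁ refl) | yes (inj₂ refl) = ⊥-elim (s≢t e)
      ... | yes (inj₂ refl) | yes (inj₁ refl) = ⊥-elim (t≢s e)
      ... | yes (inj₂ refl) | yes (inj₂ refl) = refl

    ∼c-restrict : ∀ {u v} → u ∼c v → restrict s t u ≡ restrict s t v
    ∼c-restrict c-refl        = refl
    ∼c-restrict (c-sym p)     = sym (∼c-restrict p)
    ∼c-restrict (c-trans p q) = trans (∼c-restrict p) (∼c-restrict q)
    ∼c-restrict (c-swap u v e) =
      trans (filter-++ P? u _) (trans (cong (restrict s t u ++_) (swap-restrict v e)) (sym (filter-++ P? u _)))

  restrict-∷ : ∀ {s t x} → (x ≡ s) ⊎ (x ≡ t) → ∀ u → restrict s t (x ∷ u) ≡ x ∷ restrict s t u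
  restrict-∷ {s} {t} p u = filter-accept (among? s t) p

-- Weak star reducibility in terms of words.

module Symmetric (C : CoxSys) (m-sym : ∀ s t → CoxSys.m C s t ≡ CoxSys.m C t s)
                 (m-diag : ∀ s → CoxSys.m C s s ≡ 1) where
  open Coxeter C public

  ≥3⇒≢2 : ∀ {k} → 3 ≤ k → k ≢ 2
  ≥3⇒≢2 (s≤s (s≤s ())) refl

  ≥3⇒distinct : ∀ {s t} → 3 ≤ m s t → s ≢ t
  ≥3⇒distinct {s} l refl with subst (3 ≤_) (m-diag s) l
  ... | s≤s ()

  -- Restricted to `s` and `t`, the two words agree on the image of `x` and then continue with
  -- different letters.
  alt-order : ∀ {s t k} x {y z} → 3 ≤ m s t → 1 ≤ k → ¬ (x ++ alt C s t k ++ y ∼c x ++ alt C t s k ++ z)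
  alt-order {s} {t} {suc k} x {y} {z} l _ p =
    ≥3⇒distinct l (∷-injectiveˡ (++-cancelˡ (restrict s t x) _ _
        (trans (sym (head (inj₁ refl))) (trans eq (head (inj₂ refl))))))
    where
    eq = ∼c-restrict (≥3⇒≢2 l) (≥3⇒≢2 (subst (3 ≤_) (m-sym s t) l)) p
    head : ∀ {a v} → (a ≡ s) ⊎ (a ≡ t) → restrict s t (x ++ a ∷ v) ≡ restrict s t x ++ a ∷ restrict s t v
    head a∈ = trans (filter-++ (among? s t) x _) (cong (restrict s t x ++_) (restrict-∷ a∈ _))

  alt-length-swap : ∀ s t k x y → length (x ++ alt C s t k ++ y) ≡ length (x ++ alt C t s k ++ y)
  alt-length-swap s t k x y
    rewrite length-++ x {alt C s t k ++ y} | length-++ x {alt C t s k ++ y}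
          | length-++ (alt C s t k) {y} | length-++ (alt C t s k) {y}
          | length-alt s t k | length-alt t s k = refl

  -- The braid relation turns `b` into a second reduced word of `w`, and `alt-order` keeps the two
  -- in different commutation classes.
  long-braid⇒¬FC : ∀ {w s t} x y → Gen C s → Gen C t → 3 ≤ m s t → let b = x ++ alt C s t (m s t) ++ y in
                   Word C b → b ∼ w → Reduced C b → ¬ FullyCommutative C w
  long-braid⇒¬FC {w} {s} {t} x y gs gt l wb p r fc =
    alt-order x l (≤-trans (s≤s z≤n) l)
      (fc _ _ wb wb′ p (≈-trans (≈-sym br) p) r
          (reduced-≤ r br (≤-reflexive (sym (alt-length-swap s t (m s t) x y)))))
    where
    br : x ++ alt C s t (m s t) ++ y ∼ x ++ alt C t s (m s t) ++ y
    br = ≈-braid x y gs gt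
    altW : ∀ {s t} → Gen C s → Gen C t → ∀ k → Word C (alt C s t k)
    altW gs gt zero    = []
    altW gs gt (suc k) = gs ∷ altW gt gs k
    wb′ : Word C (x ++ alt C t s (m s t) ++ y)
    wb′ = All.++⁺ (All.++⁻ˡ x wb) (All.++⁺ (altW gt gs (m s t)) (All.++⁻ʳ (alt C s t (m s t)) (All.++⁻ʳ x wb)))

  -- Conditions on the commutation class of one word; the combinatorics of letters below starts from
  -- these alone. A factor of length `m s t ∸ 1` at the start is a braid that lacks one letter on
  -- its left.
  record LeftIrreducible (a : List ℕ) : Set where
    field
      word      : Word C a
      no-square : ∀ s x y → ¬ (a ∼c x ++ s ∷ s ∷ y)
      no-braid  : ∀ s t x y → 3 ≤ m s t → ¬ (a ∼c x ++ alt C s t (m s t) ++ y)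
      no-start  : ∀ s t y → 3 ≤ m s t → ¬ (a ∼c alt C s t (m s t ∸ 1) ++ y)

  -- If tw were shorter than w, then w would have one reduced word starting with t and,
  -- by hypothesis, another one starting with s t; full commutativity forbids both orders.
  extend-reduced : ∀ {a s t y} → FullyCommutative C a → Word C a → Reduced C a → 3 ≤ m s t → Gen C t →
                   a ∼c s ∷ y → Reduced C (t ∷ a)
  extend-reduced {a} {s} {t} {y} fc wa ra l gt p v wv q with suc (length a) ≤? length v
  ... | yes le = le
  ... | no  gt′ = ⊥-elim (alt-order {s} {t} {1} [] l (s≤s z≤n) (c-trans (c-sym p) a∼c))
    where
    len : ∀ u v → parity u ≡ not (parity v) → length u ≢ length v
    len []      (x ∷ v) e ()
    len (x ∷ u) (y ∷ v) e f = len u v (not-injective e) (suc-injective f)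
    len [] [] ()
    v<a : length v < length a
    v<a with m≤n⇒m<n∨m≡n (≤-pred (≰⇒> gt′))
    ... | inj₁ lt = lt
    -- `v` has the parity of `t ∷ a`, hence not the length of `a`.
    ... | inj₂ e  = ⊥-elim (len v a (∼-parity q) e)
    tv∼a : t ∷ v ∼ a
    tv∼a = ≈-trans (∼-∷ t q) (≈-cancel [] a gt)
    a∼c : a ∼c t ∷ v
    a∼c = fc _ _ wa (gt ∷ wv) ≈-refl tv∼a ra (reduced-≤ ra (≈-sym tv∼a) v<a)

  leftIrreducible : ∀ {w a} → FullyCommutative C w → (∀ s t → ¬ LeftWeakStarReducible C s t w) →
                    Word C a → a ∼ w → Reduced C a → LeftIrreducible a
  leftIrreducible {w} {a} fc ¬red wa p ra = record
    { word      = wa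
    ; no-square = sq
    ; no-braid  = br
    ; no-start  = st
    }
    where
    red : ∀ {b} → a ∼c b → Reduced C b
    red q = reduced-≤ ra (∼c⇒∼ wa q) (≤-reflexive (Perm.↭-length (∼c⇒↭ (c-sym q))))
    sq : ∀ s x y → ¬ (a ∼c x ++ s ∷ s ∷ y)
    sq s x y q with ∼c-Word q wa
    ... | wb with All.++⁻ʳ x wb
    ... | gs ∷ _ ∷ wy = <-irrefl refl (≤-trans (shorter x) (red q (x ++ y) (All.++⁺ (All.++⁻ˡ x wb) wy)
        (≈-sym (≈-cancel x y gs))))
      where
      shorter : ∀ x → length (x ++ y) < length (x ++ s ∷ s ∷ y)
      shorter []      = s≤s (n≤1+n _)
      shorter (_ ∷ x) = s≤s (shorter x)
    br : ∀ s t x y → 3 ≤ m s t → ¬ (a ∼c x ++ alt C s t (m s t) ++ y)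
    br s t x y l q = long-braid⇒¬FC x y gs gt l wb (≈-trans (≈-sym (∼c⇒∼ wa q)) p) (red q) fc
      where
      wb = ∼c-Word q wa
      gens : ∀ {k} → 3 ≤ k → Word C (alt C s t k) → Gen C s × Gen C t
      gens (s≤s (s≤s _)) (g ∷ h ∷ _) = g , h
      g2 = gens l (All.++⁻ˡ (alt C s t (m s t)) (All.++⁻ʳ x wb))
      gs = proj₁ g2
      gt = proj₂ g2
    -- Dropping `s`, then `t`, from such a word leaves reduced words that witness both descents, and
    -- `t ∷ a` is reduced and starts with a full braid: `w` would be left weak star reducible.
    st : ∀ s t y → 3 ≤ m s t → ¬ (a ∼c alt C s t (m s t ∸ 1) ++ y)
    st s t y l q with m s t in mst | l
    ... | suc (suc (suc k)) | s≤s (s≤s (s≤s _)) = case (∼c-Word q wa)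
      where
      z = alt C s t k ++ y
      l′ : 3 ≤ m s t
      l′ = subst (3 ≤_) (sym mst) (s≤s (s≤s (s≤s z≤n)))
      mts : m t s ≡ suc (suc (suc k))
      mts = trans (m-sym t s) mst
      case : Word C (s ∷ t ∷ z) → ⊥
      case (gs ∷ gt ∷ wz) = ¬red s t
        (gs , gt , l′
        , (length (t ∷ z) , length a
          , (t ∷ z , gt ∷ wz , ≈-trans (≈-sym (≈-cancel [] _ gs)) (∼-∷ s stz∼w) , rtz , refl)
          , (a , wa , p , ra , refl)
          , ≤-reflexive (sym len))
        , (length z , length (t ∷ z)
          , (z , wz , ≈-trans (≈-sym (≈-cancel [] _ gt)) (∼-∷ t
              (≈-trans (≈-sym (≈-cancel [] _ gs)) (∼-∷ s stz∼w))) , reduced-tail gt rtz , refl)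
          , (t ∷ z , gt ∷ wz , ≈-trans (≈-sym (≈-cancel [] _ gs)) (∼-∷ s stz∼w) , rtz , refl)
          , ≤-refl)
        , λ fct → long-braid⇒¬FC [] y gt gs (subst (3 ≤_) (m-sym s t) l′) (subst (Word C) alt≡ (gt ∷ gs ∷ gt ∷ wz))
                    (≈-trans (≡⇒∼ (sym alt≡)) (≈-trans (∼-∷ t (≈-sym a∼)) (∼-∷ t p)))
                    (subst (Reduced C) alt≡ (reduced-≤ rta (∼-∷ t a∼) (s≤s (≤-reflexive (sym len))))) fct)
        where
        a∼ : a ∼ s ∷ t ∷ z
        a∼ = ∼c⇒∼ wa q
        len : length a ≡ length (s ∷ t ∷ z)
        len = Perm.↭-length (∼c⇒↭ q)
        stz∼w : s ∷ t ∷ z ∼ w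
        stz∼w = ≈-trans (≈-sym a∼) p
        rtz : Reduced C (t ∷ z)
        rtz = reduced-tail gs (red q)
        rta : Reduced C (t ∷ a)
        rta = extend-reduced (FC-resp (≈-sym p) fc) wa ra l′ gt q
        alt≡ : t ∷ s ∷ t ∷ z ≡ alt C t s (m t s) ++ y
        alt≡ rewrite mts = refl

  -- The two descents make every word of `w` at least two letters longer than a reduced word of
  -- `t s w`. Prefixing `s t` to the latter attains this bound.
  left-factor : ∀ {s t w} → Word C w → LeftWeakStarReducible C s t w →
                Σ (List ℕ) λ v → Word C (s ∷ t ∷ v) × s ∷ t ∷ v ∼ w × Reduced C (s ∷ t ∷ v)
  left-factor {s} {t} {w} ww (gs , gt , l , (_ , _ , (v₁ , w₁ , p₁ , r₁ , refl) , (v₁′ , w₁′ , p₁′ , r₁′ , refl) , lt₁)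
                            , (_ , _ , (v₂ , w₂ , p₂ , r₂ , refl) , (v₂′ , w₂′ , p₂′ , r₂′ , refl) , lt₂) , _) =
    v₂ , gs ∷ gt ∷ w₂ , stv∼w
    , λ x wx q → ≤-trans (s≤s lt₂) (≤-trans (s≤s (r₂′ v₁ w₁ (≈-trans p₁ (≈-sym p₂′))))
                   (≤-trans lt₁ (r₁′ x wx (≈-trans q (≈-trans stv∼w (≈-sym p₁′))))))
    where
    stv∼w : s ∷ t ∷ v₂ ∼ w
    stv∼w = ≈-trans (∼-∷ s (∼-∷ t p₂)) (≈-trans (∼-∷ s (≈-cancel [] _ gt)) (≈-cancel [] w gs))

-- Entries of the Coxeter matrix of type B.

data Proximity : ℕ → ℕ → Set where
  same : ∀ {i} → Proximity i i
  next : ∀ {i} → Proximity i (suc i)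
  prev : ∀ {i} → Proximity (suc i) i
  far> : ∀ {i j} → suc (suc i) ≤ j → Proximity i j
  far< : ∀ {i j} → suc (suc j) ≤ i → Proximity i j

proximity : ∀ i j → Proximity i j
proximity zero zero = same
proximity zero (suc zero) = next
proximity zero (suc (suc j)) = far> (s≤s (s≤s z≤n))
proximity (suc zero) zero = prev
proximity (suc (suc i)) zero = far< (s≤s (s≤s z≤n))
proximity (suc i) (suc j) with proximity i j
... | same   = same
... | next   = next
... | prev   = prev
... | far> l = far> (s≤s l)
... | far< l = far< (s≤s l)

-- `mB` tests for the indices 1 and 2, so small indices are evaluated case by case. From 3 on these
-- tests fail, and the remaining ones are invariant under a common shift, which `go` strips off.
mB-far : ∀ {i j} → suc (suc i) ≤ j → mB i j ≡ 2
mB-far {0} (s≤s (s≤s _)) = refl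
mB-far {1} (s≤s (s≤s (s≤s _))) = refl
mB-far {2} (s≤s (s≤s (s≤s (s≤s _)))) = refl
mB-far {suc (suc (suc i))} (s≤s (s≤s (s≤s l))) = go i l
  where
  go : ∀ i {j} → suc (suc i) ≤ j → mB (3 + i) (3 + j) ≡ 2
  go zero    (s≤s (s≤s _)) = refl
  go (suc i) (s≤s l)       = go i l

mB-far′ : ∀ {i j} → suc (suc j) ≤ i → mB i j ≡ 2
mB-far′ {2} {0} _ = refl
mB-far′ {suc (suc (suc i))} {0} _ = refl
mB-far′ {1} {0} (s≤s ())
mB-far′ {j = 1} (s≤s (s≤s (s≤s _))) = refl
mB-far′ {j = 2} (s≤s (s≤s (s≤s (s≤s _)))) = refl
mB-far′ {j = suc (suc (suc j))} (s≤s (s≤s (s≤s l))) = go j l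
  where
  go : ∀ j {i} → suc (suc j) ≤ i → mB (3 + i) (3 + j) ≡ 2
  go zero    (s≤s (s≤s _)) = refl
  go (suc j) (s≤s l)       = go j l

mB-next : ∀ j → mB (2 + j) (3 + j) ≡ 3
mB-next 0 = refl
mB-next (suc j) = go j
  where
  go : ∀ j → mB (3 + j) (4 + j) ≡ 3
  go zero    = refl
  go (suc j) = go j

mB-prev : ∀ j → mB (3 + j) (2 + j) ≡ 3
mB-prev 0 = refl
mB-prev (suc j) = go j
  where
  go : ∀ j → mB (4 + j) (3 + j) ≡ 3
  go zero    = refl
  go (suc j) = go j

mB-diag : ∀ i → mB i i ≡ 1
mB-diag 0 = refl
mB-diag 1 = refl
mB-diag 2 = refl
mB-diag (suc (suc (suc i))) = go i
  where
  go : ∀ i → mB (3 + i) (3 + i) ≡ 1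
  go zero    = refl
  go (suc i) = go i

mB-sym : ∀ i j → mB i j ≡ mB j i
mB-sym i j with proximity i j
... | same                     = refl
... | next {0}                 = refl
... | next {1}                 = refl
... | next {suc (suc k)}       = trans (mB-next k) (sym (mB-prev k))
... | prev {0}                 = refl
... | prev {1}                 = refl
... | prev {suc (suc k)}       = trans (mB-prev k) (sym (mB-next k))
... | far> l                   = trans (mB-far l) (sym (mB-far′ l))
... | far< l                   = trans (mB-far′ l) (sym (mB-far l))

mB-distant : ∀ i x → x ≢ i → x ≢ suc i → x ≢ suc (suc i) → mB x (suc i) ≡ 2
mB-distant i x p q r with proximity x (suc i)
... | same   = ⊥-elim (q refl)
... | next   = ⊥-elim (p refl)
... | prev   = ⊥-elim (r refl)
... | far> l = mB-far l
... | far< l = mB-far′ l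

-- Codes of signed permutations and the action of the generators.

-- W(B_n) is coded by lists of n pairs (b , v), v ≤ k, where k is the length of the tail.  A pair stands
-- for the right coset of W(B_k) in W(B_{k+1}) with minimal representative coset k b v; in terms of signed
-- permutations it is the place v + 1 and the sign of one entry.  act s is right multiplication by s_s: it
-- moves the coset at the top, or fixes it and passes a conjugate generator down to the tail.
Code : Set
Code = List (Bool × ℕ)

data Step : Set where
  flip : Step
  move : ℕ → Step
  pass : ℕ → Step

shift : Step → Step
shift flip     = flip
shift (move v) = move (suc v)
shift (pass r) = pass (suc r)

-- s_{j+2} exchanges the places j and j + 1, counted from 0. If the top entry is at neither, the
-- generator acts on the remaining entries, whose places beyond `v` drop by one when the top entry
-- is removed: hence index j + 1 for v < j, and j + 2 for v > j + 1.
transpose : ℕ → ℕ → Step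
transpose zero    zero          = move 1
transpose zero    (suc zero)    = move 0
transpose zero    (suc (suc v)) = pass 2
transpose (suc j) zero          = pass (suc (suc j))
transpose (suc j) (suc v)       = shift (transpose j v)

step : ℕ → ℕ → Step
-- A default: 0 is not a generator, and `act 0` fixes every code.
step zero          v       = pass 0
step (suc zero)    zero    = flip
step (suc zero)    (suc v) = pass 1
step (suc (suc j)) v       = transpose j v

mutual
  act : ℕ → Code → Code
  act s []            = []
  act s ((b , v) ∷ x) = apply (step s v) b v x

  apply : Step → Bool → ℕ → Code → Code
  apply flip     b v x = (not b , v) ∷ x
  apply (move u) b v x = (b , u) ∷ x
  apply (pass r) b v x = (b , v) ∷ act r x

transpose-self : ∀ j → transpose j j ≡ move (suc j)
transpose-self zero    = refl
transpose-self (suc j) = cong shift (transpose-self j)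

transpose-next : ∀ j → transpose j (suc j) ≡ move j
transpose-next zero    = refl
transpose-next (suc j) = cong shift (transpose-next j)

transpose-above : ∀ {j v} → suc (suc j) ≤ v → transpose j v ≡ pass (suc (suc j))
transpose-above {zero}  (s≤s (s≤s _)) = refl
transpose-above {suc j} (s≤s l)       = cong shift (transpose-above l)

transpose-below : ∀ {j v} → suc v ≤ j → transpose j v ≡ pass (suc j)
transpose-below {suc j} {zero}  _       = refl
transpose-below {suc j} {suc v} (s≤s l) = cong shift (transpose-below l)

module _ {b : Bool} {x : Code} where
  act-self : ∀ j → act (2 + j) ((b , j) ∷ x) ≡ (b , suc j) ∷ x
  act-self j = cong (λ m → apply m b j x) (transpose-self j)

  act-next : ∀ j → act (2 + j) ((b , suc j) ∷ x) ≡ (b , j) ∷ x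
  act-next j = cong (λ m → apply m b (suc j) x) (transpose-next j)

  act-above : ∀ {j v} → suc (suc j) ≤ v → act (2 + j) ((b , v) ∷ x) ≡ (b , v) ∷ act (2 + j) x
  act-above {v = v} l = cong (λ m → apply m b v x) (transpose-above l)

  act-below : ∀ {j v} → suc v ≤ j → act (2 + j) ((b , v) ∷ x) ≡ (b , v) ∷ act (suc j) x
  act-below {v = v} l = cong (λ m → apply m b v x) (transpose-below l)

data Position (j : ℕ) : ℕ → Set where
  below : ∀ {v} → suc v ≤ j → Position j v
  self  : Position j j
  after : Position j (suc j)
  above : ∀ {v} → suc (suc j) ≤ v → Position j v

position : ∀ j v → Position j v
position j v with proximity j v
... | same   = self
... | next   = after
... | prev   = below ≤-refl
... | far> l = above l
... | far< l = below (≤-trans (n≤1+n _) l)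

-- The Coxeter relations for the action.

act-involutive : ∀ s x → act (suc s) (act (suc s) x) ≡ x
act-involutive s [] = refl
act-involutive zero    ((b , zero) ∷ x)  = cong (λ c → (c , 0) ∷ x) (not-involutive b)
act-involutive zero    ((b , suc v) ∷ x) = cong ((b , suc v) ∷_) (act-involutive 0 x)
act-involutive (suc j) ((b , v) ∷ x) with position j v
... | self    = trans (cong (act _) (act-self j)) (act-next j)
... | after   = trans (cong (act _) (act-next j)) (act-self j)
... | above l = trans (cong (act _) (act-above l)) (trans (act-above l) (cong (_ ∷_) (act-involutive (suc j) x)))
... | below {v} l = trans (cong (act _) (act-below l)) (trans (act-below l) (cong (_ ∷_) (act-involutive j x)))

Commute : ℕ → ℕ → Code → Set
Commute s t x = act s (act t x) ≡ act t (act s x)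

-- At most one of the two generators moves or flips the top entry. The places concerned are
-- disjoint, so the other one passes to the same index before and after that move.
act-commute : ∀ s t → 1 ≤ s → suc (suc s) ≤ t → ∀ x → Commute s t x
act-commute s t p l [] = refl
act-commute 1 (suc (suc (suc j))) p (s≤s (s≤s (s≤s l))) ((b , zero) ∷ x) = refl
act-commute 1 (suc (suc j@(suc k))) p l ((b , v@(suc w)) ∷ x) with position j v
... | self    = trans (cong (act 1) (act-self j)) (sym (act-self j))
... | after   = trans (cong (act 1) (act-next j)) (sym (act-next j))
... | above h = trans (cong (act 1) (act-above h)) (trans (cong (_ ∷_) (act-commute 1 (2 + j) p l x))
    (sym (act-above h)))
... | below h = trans (cong (act 1) (act-below h)) (trans (cong (_ ∷_)
    (act-commute 1 (suc j) p (≤-trans (s≤s (s≤s (s≤s z≤n))) (s≤s h)) x)) (sym (act-below h)))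
act-commute (suc (suc i)) (suc (suc j)) p (s≤s (s≤s l)) ((b , v) ∷ x) with position i v
... | self = trans (cong (act _) (act-below (≤-trans (n≤1+n _) l)))
    (trans (act-self i) (sym (trans (cong (act _) (act-self i)) (act-below l))))
... | after = trans (cong (act _) (act-below l)) (trans (act-next i)
    (sym (trans (cong (act _) (act-next i)) (act-below (≤-trans (n≤1+n _) l)))))
act-commute (suc (suc i@(suc i′))) (suc (suc j@(suc j′))) p (s≤s (s≤s l)) ((b , v) ∷ x) | below h =
  trans (cong (act _) (act-below h′)) (trans (act-below h)
    (trans (cong (_ ∷_) (act-commute (suc i) (suc j) (s≤s z≤n) (s≤s l) x))
    (sym (trans (cong (act _) (act-below h)) (act-below h′)))))
  where h′ = ≤-trans h (≤-trans (n≤1+n _) (≤-trans (n≤1+n _) l))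
act-commute (suc (suc i)) (suc (suc j)) p (s≤s (s≤s l)) ((b , v) ∷ x) | above h with position j v
... | self = trans (cong (act _) (act-self j)) (trans (act-above (≤-trans h (n≤1+n _)))
    (sym (trans (cong (act _) (act-above h)) (act-self j))))
... | after = trans (cong (act _) (act-next j)) (trans (act-above l)
    (sym (trans (cong (act _) (act-above h)) (act-next j))))
... | above h′ = trans (cong (act _) (act-above h′)) (trans (act-above h)
    (trans (cong (_ ∷_) (act-commute _ _ p (s≤s (s≤s l)) x))
    (sym (trans (cong (act _) (act-above h)) (act-above h′)))))
... | below h′ = trans (cong (act _) (act-below h′)) (trans (act-above h)
    (trans (cong (_ ∷_) (act-commute _ _ p (s≤s (≤-trans (s≤s h) h′)) x))
    (sym (trans (cong (act _) (act-above h)) (act-below h′)))))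

-- Both sides reflect a top entry within the places i, i + 1, i + 2 and hand the single generator
-- `2 + i` to the tail. A top entry elsewhere hands the whole relation down, with indices lowered by
-- one if it lies below.
act-braid₃ : ∀ i x → let s = 2 + i ; t = 3 + i in act s (act t (act s x)) ≡ act t (act s (act t x))
act-braid₃ i [] = refl
act-braid₃ i ((b , v) ∷ x) with position i v
... | self =
  trans (cong (λ z → act (2 + i) (act (3 + i) z)) (act-self i))
  (trans (cong (act (2 + i)) (act-self (suc i)))
  (trans (act-above ≤-refl)
  (sym (trans (cong (λ z → act (3 + i) (act (2 + i) z)) (act-below ≤-refl))
  (trans (cong (act (3 + i)) (act-self i)) (act-self (suc i)))))))
... | after =
  trans (cong (λ z → act (2 + i) (act (3 + i) z)) (act-next i))
  (trans (cong (act (2 + i)) (act-below ≤-refl))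
  (trans (act-self i)
  (sym (trans (cong (λ z → act (3 + i) (act (2 + i) z)) (act-self (suc i)))
  (trans (cong (act (3 + i)) (act-above ≤-refl)) (act-next (suc i)))))))
... | below h =
  trans (cong (λ z → act (2 + i) (act (3 + i) z)) (act-below h))
  (trans (cong (act (2 + i)) (act-below (≤-trans h (n≤1+n _))))
  (trans (act-below h)
  (trans (cong (_ ∷_) (low h))
  (sym (trans (cong (λ z → act (3 + i) (act (2 + i) z)) (act-below (≤-trans h (n≤1+n _))))
  (trans (cong (act (3 + i)) (act-below h)) (act-below (≤-trans h (n≤1+n _)))))))))
  where
  low : ∀ {i w} → suc w ≤ i → act (suc i) (act (2 + i) (act (suc i) x)) ≡ act (2 + i) (act (suc i) (act (2 + i) x))
  low {suc i} _ = act-braid₃ i x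
... | above h with position (suc i) v
...   | self     = ⊥-elim (1+n≰n h)
...   | below h′ = ⊥-elim (1+n≰n (≤-trans (≤-trans (n≤1+n _) h) (≤-pred h′)))
...   | after =
  trans (cong (λ z → act (2 + i) (act (3 + i) z)) (act-above ≤-refl))
  (trans (cong (act (2 + i)) (act-next (suc i)))
  (trans (act-next i)
  (sym (trans (cong (λ z → act (3 + i) (act (2 + i) z)) (act-next (suc i)))
  (trans (cong (act (3 + i)) (act-next i)) (act-below ≤-refl))))))
...   | above h′ =
  trans (cong (λ z → act (2 + i) (act (3 + i) z)) (act-above h))
  (trans (cong (act (2 + i)) (act-above h′))
  (trans (act-above h)
  (trans (cong (_ ∷_) (act-braid₃ i x))
  (sym (trans (cong (λ z → act (3 + i) (act (2 + i) z)) (act-above h′))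
  (trans (cong (act (3 + i)) (act-above h)) (act-above h′)))))))

act-braid₄ : ∀ x → act 1 (act 2 (act 1 (act 2 x))) ≡ act 2 (act 1 (act 2 (act 1 x)))
act-braid₄ []                    = refl
act-braid₄ ((b , 0) ∷ x)         = refl
act-braid₄ ((b , 1) ∷ x)         = refl
act-braid₄ ((b , suc (suc v)) ∷ x) = cong (_ ∷_) (act-braid₄ x)

-- Minimal coset representatives and the words of codes.

descend : ℕ → ℕ → List ℕ
descend zero    v = []
descend (suc c) v = 2 + (c + v) ∷ descend c v

ascend : ℕ → ℕ → List ℕ
ascend a zero    = []
ascend a (suc v) = a ∷ ascend (suc a) v

-- The representatives s_{k+1} ... s_{v+2} for a positive entry and s_{k+1} ... s_2 s_1 s_2 ...
-- s_{v+1} for a negative one.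
coset : ℕ → Bool → ℕ → List ℕ
coset k true  v = descend (k ∸ v) v
coset k false v = descend k 0 ++ 1 ∷ ascend 2 v

word : Code → List ℕ
word []            = []
word ((b , v) ∷ x) = word x ++ coset (length x) b v

Valid : Code → Set
Valid []            = ⊤
Valid ((b , v) ∷ x) = v ≤ length x × Valid x

descend-snoc : ∀ c v → descend (suc c) v ≡ descend c (suc v) ++ [ 2 + v ]
descend-snoc zero    v = refl
descend-snoc (suc c) v = cong₂ _∷_ (cong (2 +_) (sym (+-suc c v))) (descend-snoc c v)

ascend-snoc : ∀ a v → ascend a (suc v) ≡ ascend a v ++ [ a + v ]
ascend-snoc a zero    = cong [_] (sym (+-identityʳ a))
ascend-snoc a (suc v) = cong (a ∷_) (trans (ascend-snoc (suc a) v)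
    (cong (λ z → ascend (suc a) v ++ [ z ]) (sym (+-suc a v))))

descend-≥ : ∀ c v → All (2 + v ≤_) (descend c v)
descend-≥ zero    v = []
descend-≥ (suc c) v = s≤s (s≤s (m≤n+m v c)) ∷ descend-≥ c v

descend-≤ : ∀ c v → All (_≤ suc (c + v)) (descend c v)
descend-≤ zero    v = []
descend-≤ (suc c) v = ≤-refl ∷ All.map (λ l → ≤-trans l (n≤1+n _)) (descend-≤ c v)

ascend-≥ : ∀ a v → All (a ≤_) (ascend a v)
ascend-≥ a zero    = []
ascend-≥ a (suc v) = ≤-refl ∷ All.map (≤-trans (n≤1+n _)) (ascend-≥ (suc a) v)

ascend-< : ∀ a v → All (_< a + v) (ascend a v)
ascend-< a zero    = []
ascend-< a (suc v) = subst (a <_) (sym (+-suc a v)) (s≤s (m≤m+n a v)) ∷ subst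
    (λ z → All (_< z) (ascend (suc a) v)) (sym (+-suc a v)) (ascend-< (suc a) v)

length-act : ∀ s x → length (act s x) ≡ length x
length-act s [] = refl
length-act s ((b , v) ∷ x) with step s v
... | flip   = refl
... | move u = refl
... | pass r = cong suc (length-act r x)

coset-pos : ∀ {j k} → suc j ≤ k → coset k true j ≡ coset k true (suc j) ++ [ 2 + j ]
coset-pos {j} {suc k} (s≤s l) =
  trans (cong (λ c → descend c j) (+-∸-assoc 1 l)) (descend-snoc (k ∸ j) j)

coset-neg : ∀ j k → coset k false (suc j) ≡ coset k false j ++ [ 2 + j ]
coset-neg j k = trans (cong (λ z → descend k 0 ++ 1 ∷ z) (ascend-snoc 2 j))
    (sym (++-assoc (descend k 0) (1 ∷ ascend 2 j) [ 2 + j ]))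

-- Normal forms and reduced words in W(B_n).

module TypeB (n : ℕ) where
  open Symmetric (WB n) mB-sym mB-diag public

  swap∼ : ∀ {s t} v → Gen (WB n) s → Gen (WB n) t → mB s t ≡ 2 → s ∷ t ∷ v ∼ t ∷ s ∷ v
  swap∼ v gs gt e = subst₂ _∼_ (cong (λ k → alt (WB n) _ _ k ++ v) e) (cong (λ k → alt (WB n) _ _ k ++ v) e)
      (≈-braid [] v gs gt)

  braid₃∼ : ∀ {s t} v → Gen (WB n) s → Gen (WB n) t → mB s t ≡ 3 → s ∷ t ∷ s ∷ v ∼ t ∷ s ∷ t ∷ v
  braid₃∼ v gs gt e = subst₂ _∼_ (cong (λ k → alt (WB n) _ _ k ++ v) e) (cong (λ k → alt (WB n) _ _ k ++ v) e)
      (≈-braid [] v gs gt)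

  pass∼ʳ : ∀ {g u} z → Gen (WB n) g → Word (WB n) u → All (λ x → mB x g ≡ 2) u → u ++ g ∷ z ∼ g ∷ u ++ z
  pass∼ʳ {g} {u} z gg w e = subst₂ _∼_ (++-assoc u [ g ] z) (cong (λ v → g ∷ v ++ z) (++-identityʳ u))
    (∼-++ʳ z (∼c⇒∼ (All.++⁺ w (gg ∷ [])) (∼c-pass [] e)))

  pass∼ : ∀ {g u} → Gen (WB n) g → Word (WB n) u → All (λ x → mB x g ≡ 2) u → u ++ [ g ] ∼ g ∷ u
  pass∼ {g} {u} gg w e = ≈-trans (pass∼ʳ [] gg w e) (≡⇒∼ (cong (g ∷_) (++-identityʳ u)))

  descend-Word : ∀ c v → c + v < n → Word (WB n) (descend c v)
  descend-Word c v l = All.zipWith (λ (p , q) → ≤-trans (s≤s z≤n) p , ≤-trans q l) (descend-≥ c v , descend-≤ c v)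

  ascend-Word : ∀ a v → 1 ≤ a → a + v ≤ suc n → Word (WB n) (ascend a v)
  ascend-Word a v l h = All.zipWith (λ (p , q) → ≤-trans l p , ≤-pred (≤-trans q h)) (ascend-≥ a v , ascend-< a v)

  descend-above : ∀ c v g → 1 ≤ g → g ≤ v → c + v < n → descend c v ++ [ g ] ∼ g ∷ descend c v
  descend-above c v g p q l = pass∼ (p , ≤-trans q (≤-trans (m≤n+m v c) (≤-trans (n≤1+n _) l))) (descend-Word c v l)
    (All.map (λ h → mB-far′ (≤-trans (s≤s (s≤s q)) h)) (descend-≥ c v))

  -- Moving left, the new letter commutes with the end of the run until it meets `3 + j`, `2 + j`.
  -- The braid relation then sends out `2 + j` on the left, which commutes with the larger letters.
  descend-below : ∀ c v j → v ≤ j → 2 + j ≤ c + v → c + v < n → descend c v ++ [ 3 + j ] ∼ 2 + j ∷ descend c v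
  descend-below zero    v j p q l = ⊥-elim (1+n≰n (≤-trans (n≤1+n _) (≤-trans q p)))
  descend-below (suc c) v j p q l with m≤n⇒m<n∨m≡n q
  ... | inj₁ q′ = ≈-trans (∼-∷ _ (descend-below c v j p (≤-pred q′) (≤-trans (n≤1+n _) l)))
                   (swap∼ _ (s≤s z≤n , l) (s≤s z≤n , ≤-trans q (≤-trans (n≤1+n _) l)) (mB-far′ (s≤s q′)))
  descend-below (suc zero)    v j p q l | inj₂ refl = ⊥-elim (1+n≰n p)
  descend-below (suc (suc c)) v j p q l | inj₂ refl =
    ≈-trans (∼-∷ _ (∼-∷ _ (pass∼ (s≤s z≤n , l) (descend-Word c v (≤-trans (n≤1+n _) (≤-trans (n≤1+n _) l)))
      (All.map (λ h → mB-far (s≤s (s≤s h))) (descend-≤ c v)))))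
      (braid₃∼ _ (s≤s z≤n , l) (s≤s z≤n , ≤-trans (n≤1+n _) l) (mB-prev (c + v)))

  ascend-low : ∀ v j → 2 + j ≤ v → v < n → ascend 2 v ++ [ 2 + j ] ∼ 3 + j ∷ ascend 2 v
  ascend-low (suc v) j p l with m≤n⇒m<n∨m≡n p
  ... | inj₁ p′ = ≈-trans (≡⇒∼ (trans (cong (_++ [ 2 + j ]) (ascend-snoc 2 v)) (++-assoc (ascend 2 v) _ _)))
        (≈-trans (∼-++ˡ (ascend 2 v) (swap∼ [] (s≤s z≤n , l) (s≤s z≤n , ≤-trans p (≤-trans (n≤1+n _) l))
            (mB-far′ (s≤s p′))))
        (≈-trans (≡⇒∼ (sym (++-assoc (ascend 2 v) _ _)))
        (≈-trans (∼-++ʳ [ 2 + v ] (ascend-low v j (≤-pred p′) (≤-trans (n≤1+n _) l)))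
        (≡⇒∼ (cong (3 + j ∷_) (sym (ascend-snoc 2 v)))))))
  ... | inj₂ refl = ≈-trans (≡⇒∼ (trans (cong (_++ [ 2 + j ]) two) (++-assoc (ascend 2 j) _ _)))
        (≈-trans (∼-++ˡ (ascend 2 j) (braid₃∼ [] (s≤s z≤n , ≤-trans (n≤1+n _) l) (s≤s z≤n , l) (mB-next j)))
        (≈-trans (pass∼ʳ _ (s≤s z≤n , l) (ascend-Word 2 j (s≤s z≤n) (≤-trans (n≤1+n _) (≤-trans l (n≤1+n _))))
            (All.map (λ h → mB-far (s≤s h)) (ascend-< 2 j)))
        (≡⇒∼ (cong (3 + j ∷_) (sym two)))))
    where
    two : ascend 2 (2 + j) ≡ ascend 2 j ++ (2 + j) ∷ (3 + j) ∷ []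
    two = trans (ascend-snoc 2 (suc j)) (trans (cong₂ (λ a b → a ++ [ b ]) (ascend-snoc 2 j)
        (cong (2 +_) (+-suc 0 j))) (++-assoc (ascend 2 j) _ _))

  -- Deodhar's lemma for the chain of parabolic subgroups: a minimal representative times a
  -- generator is a minimal representative again, longer or shorter, or the generator comes out on
  -- the left as one of the subgroup.
  data ActView (s : ℕ) (b : Bool) (v : ℕ) (x : Code) : Set where
    longer  : let y = act s ((b , v) ∷ x) in Valid y → word y ≡ word ((b , v) ∷ x) ++ [ s ] → ActView s b v x
    shorter : let y = act s ((b , v) ∷ x) in Valid y → word ((b , v) ∷ x) ≡ word y ++ [ s ] → ActView s b v x
    through : ∀ {r} → act s ((b , v) ∷ x) ≡ (b , v) ∷ act r x → 1 ≤ r → r ≤ length x →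
              coset (length x) b v ++ [ s ] ∼ r ∷ coset (length x) b v → ActView s b v x

  private
    end : ∀ x {c d s} → c ≡ d ++ [ s ] → word x ++ c ≡ (word x ++ d) ++ [ s ]
    end x {d = d} {s} refl = sym (++-assoc (word x) d [ s ])

  -- When the place rises by one, the representative of a positive entry loses its last letter and
  -- that of a negative entry gains one. This decides between `longer` and `shorter`.
  actView : ∀ s {b v x} → 1 ≤ s → s ≤ suc (length x) → v ≤ length x → Valid x → suc (length x) ≤ n → ActView s b v x
  actView 1 {true}  {zero} {x} p q h V l = longer (z≤n , V) (end x refl)
  actView 1 {false} {zero} {x} p q h V l = shorter (z≤n , V) (end x refl)
  actView 1 {true}  {suc w} {x} p q h V l = through refl ≤-refl (≤-trans (s≤s z≤n) h)
    (descend-above (length x ∸ suc w) (suc w) 1 p (s≤s z≤n) (subst (_< n) (sym (m∸n+n≡m h)) l))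
  actView 1 {false} {suc w} {x} p q h V l = through refl ≤-refl (≤-trans (s≤s z≤n) h) (neg₁ (length x) l h)
    where
    -- The appended 1 passes the letters from 3 on and meets 2 1 2. The braid of length four brings
    -- a 1 out in front, and that passes the rest of the descending run.
    neg₁ : ∀ k → suc k ≤ n → suc w ≤ k → coset k false (suc w) ++ [ 1 ] ∼ 1 ∷ coset k false (suc w)
    neg₁ (suc c) l (s≤s h) =
      ≈-trans (≡⇒∼ (trans (++-assoc (descend (suc c) 0) (1 ∷ 2 ∷ ascend 3 w) [ 1 ])
                   (trans (cong (_++ 1 ∷ 2 ∷ ascend 3 w ++ [ 1 ]) (descend-snoc c 0))
                       (++-assoc (descend c 1) [ 2 ] _))))
      (≈-trans (∼-++ˡ (descend c 1) (∼-++ˡ (2 ∷ 1 ∷ 2 ∷ []) (pass∼ g₁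
          (ascend-Word 3 w (s≤s z≤n) (s≤s (≤-trans (s≤s (s≤s h)) l))) (All.map mB-far′ (ascend-≥ 3 w)))))
      (≈-trans (∼-++ˡ (descend c 1) (≈-braid {s = 2} {t = 1} [] (ascend 3 w) (s≤s z≤n , ≤-trans (s≤s (s≤s z≤n)) l) g₁))
      (≈-trans (pass∼ʳ _ g₁ (descend-Word c 1 (subst (_< n) (+-comm 1 c) l)) (All.map mB-far′ (descend-≥ c 1)))
      (≡⇒∼ (cong (1 ∷_) (trans (sym (++-assoc (descend c 1) [ 2 ] _))
          (cong (_++ 1 ∷ 2 ∷ ascend 3 w) (sym (descend-snoc c 0)))))))))
      where g₁ = (≤-refl {1} , ≤-trans (s≤s z≤n) l)
  actView (suc (suc j)) {b} {v} {x} p (s≤s q) h V l with position j v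
  actView (suc (suc j)) {true}  {v} {x} p (s≤s q) h V l | self =
    shorter (subst Valid (sym (act-self j)) (q , V)) (trans (end x (coset-pos q))
        (cong (λ z → word z ++ [ 2 + j ]) (sym (act-self j))))
  actView (suc (suc j)) {false} {v} {x} p (s≤s q) h V l | self =
    longer (subst Valid (sym (act-self j)) (q , V)) (trans (cong word (act-self j)) (end x (coset-neg j _)))
  actView (suc (suc j)) {true}  {v} {x} p (s≤s q) h V l | after =
    longer (subst Valid (sym (act-next j)) (≤-trans (n≤1+n _) h , V))
        (trans (cong word (act-next j)) (end x (coset-pos h)))
  actView (suc (suc j)) {false} {v} {x} p (s≤s q) h V l | after =
    shorter (subst Valid (sym (act-next j)) (≤-trans (n≤1+n _) h , V))
        (trans (end x (coset-neg j _)) (cong (λ z → word z ++ [ 2 + j ]) (sym (act-next j))))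
  actView (suc (suc j)) {true}  {v} {x} p (s≤s q) h V l | above g =
    through (act-above g) p (≤-trans g h) (descend-above _ v (2 + j) p g (subst (_< n) (sym (m∸n+n≡m h)) l))
  actView (suc (suc j)) {false} {v} {x} p (s≤s q) h V l | above g =
    through (act-above g) p (≤-trans g h)
      -- The index rises by one on the way through the ascending run and falls back in the
      -- descending run.
      (≈-trans (≡⇒∼ (++-assoc D (1 ∷ A) _))
      (≈-trans (∼-++ˡ D (∼-∷ 1 (ascend-low v j g (≤-trans (s≤s h) l))))
      (≈-trans (∼-++ˡ D (swap∼ A (≤-refl , ≤-trans (s≤s z≤n) l) (s≤s z≤n , ≤-trans (s≤s (≤-trans g h)) l) refl))
      (≈-trans (≡⇒∼ (sym (++-assoc D [ 3 + j ] _)))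
      (∼-++ʳ (1 ∷ A) (descend-below (length x) 0 j z≤n (≤-trans g
          (≤-trans h (≤-reflexive (sym (+-identityʳ _))))) (subst (_< n) (sym (+-identityʳ _)) l)))))))
    where
    D = descend (length x) 0
    A = ascend 2 v
  actView (suc (suc (suc j))) {true}  {v} {x} p (s≤s q) h V l | below (s≤s g) =
    through (act-below (s≤s g)) (s≤s z≤n) q
      (descend-below _ v j g (≤-trans q (≤-reflexive (sym (m∸n+n≡m h)))) (subst (_< n) (sym (m∸n+n≡m h)) l))
  actView (suc (suc (suc j))) {false} {v} {x} p (s≤s q) h V l | below (s≤s g) =
    through (act-below (s≤s g)) (s≤s z≤n) q
      (≈-trans (≡⇒∼ (++-assoc D (1 ∷ A) _))
      (≈-trans (∼-++ˡ D (pass∼ gj ((≤-refl , ≤-trans (s≤s z≤n) l) ∷ ascend-Word 2 v (s≤s z≤n) (s≤s (≤-trans (s≤s h) l)))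
          (refl ∷ All.map (λ a → mB-far (s≤s (≤-trans a (s≤s (s≤s g))))) (ascend-< 2 v))))
      (≈-trans (≡⇒∼ (sym (++-assoc D [ 3 + j ] _)))
      (∼-++ʳ (1 ∷ A) (descend-below (length x) 0 j z≤n (≤-trans q (≤-reflexive (sym (+-identityʳ _))))
          (subst (_< n) (sym (+-identityʳ _)) l))))))
    where
    D = descend (length x) 0
    A = ascend 2 v
    gj = (s≤s {0} z≤n , ≤-trans (s≤s q) l)

  act-word : ∀ s x → 1 ≤ s → s ≤ length x → Valid x → length x ≤ n →
             Valid (act s x) × (word (act s x) ∼ word x ++ [ s ]) × length (word (act s x)) ≤ suc (length (word x))
  act-word s [] (s≤s _) ()
  act-word s ((b , v) ∷ x) p q (h , V) l with actView s {b} p q h V l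
  ... | longer V′ e  = V′ , ≡⇒∼ e , ≤-reflexive (trans (cong length e) (trans (length-++ (word x ++ _)) (+-comm _ 1)))
  ... | shorter V′ e = V′
      , ≈-trans (≡⇒∼ (sym (++-identityʳ w))) (≈-trans (≈-sym (≈-cancel w [] (p , ≤-trans q l)))
          (≡⇒∼ (trans (sym (++-assoc w [ s ] [ s ])) (cong (_++ [ s ]) (sym e)))))
      , ≤-trans (n≤1+n _) (≤-trans (≤-reflexive (sym (trans (cong length e)
          (trans (length-++ w) (+-comm _ 1))))) (n≤1+n _))
    where w = word (act s ((b , v) ∷ x))
  ... | through {r} e p′ q′ c rewrite e | length-act r x with act-word r x p′ q′ V (≤-trans (n≤1+n _) l)
  ...   | V′ , a , len = (h , V′)
      , ≈-trans (∼-++ʳ C a) (≈-trans (≡⇒∼ (++-assoc (word x) [ r ] C))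
          (≈-trans (∼-++ˡ (word x) (≈-sym c)) (≡⇒∼ (sym (++-assoc (word x) C [ s ])))))
      , subst₂ (λ i j → i ≤ suc j) (sym (length-++ (word (act r x)))) (sym (length-++ (word x)))
          (+-monoˡ-≤ (length C) len)
    where C = coset (length x) b v

  identity : ℕ → Code
  identity zero    = []
  identity (suc k) = (true , k) ∷ identity k

  run : Code → List ℕ → Code
  run = foldl (λ x s → act s x)

  length-identity : ∀ k → length (identity k) ≡ k
  length-identity zero    = refl
  length-identity (suc k) = cong suc (length-identity k)

  identity-valid : ∀ k → Valid (identity k)
  identity-valid zero    = tt
  identity-valid (suc k) = ≤-reflexive (sym (length-identity k)) , identity-valid k

  word-identity : ∀ k → word (identity k) ≡ []
  word-identity zero = refl
  word-identity (suc k) rewrite length-identity k | word-identity k | n∸n≡0 k = refl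

  run-++ : ∀ x u v → run x (u ++ v) ≡ run (run x u) v
  run-++ = foldl-++ _

  run-braid : ∀ {s t} → 1 ≤ s → 1 ≤ t → ∀ x → run x (alt (WB n) s t (mB s t)) ≡ run x (alt (WB n) t s (mB s t))
  run-braid {s} {t} p q x with proximity s t
  run-braid p q x | same = refl
  run-braid {1} p q x | next = sym (act-braid₄ x)
  run-braid {suc (suc i)} p q x | next rewrite mB-next i = act-braid₃ i x
  run-braid {t = 1} p q x | prev = act-braid₄ x
  run-braid {t = suc (suc i)} p q x | prev rewrite mB-prev i = sym (act-braid₃ i x)
  run-braid {s} {t} p q x | far> l rewrite mB-far l = sym (act-commute s t p l x)
  run-braid {s} {t} p q x | far< l rewrite mB-far′ l = act-commute t s q l x

  -- This makes `normal` a function of the group element.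
  run-∼ : ∀ {u v} → u ∼ v → ∀ x → run x u ≡ run x v
  run-∼ ≈-refl x        = refl
  run-∼ (≈-sym p) x     = sym (run-∼ p x)
  run-∼ (≈-trans p q) x = trans (run-∼ p x) (run-∼ q x)
  run-∼ (≈-cancel {suc s} u v (s≤s _ , _)) x =
    trans (run-++ x u _) (trans (cong (λ y → run y v) (act-involutive s (run x u))) (sym (run-++ x u v)))
  run-∼ (≈-braid {s} {t} u v (p , _) (q , _)) x =
    trans (run-++ x u _) (trans (run-++ _ (alt (WB n) s t (mB s t)) v)
    (trans (cong (λ y → run y v) (run-braid p q (run x u)))
    (sym (trans (run-++ x u _) (run-++ _ (alt (WB n) t s (mB s t)) v)))))

  run-word : ∀ u x → Word (WB n) u → length x ≡ n → Valid x →
             Valid (run x u) × length (run x u) ≡ n × (word (run x u) ∼ word x ++ u) × length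
                 (word (run x u)) ≤ length (word x) + length u
  run-word [] x [] l V = V , l , ≡⇒∼ (sym (++-identityʳ _)) , m≤m+n _ 0
  run-word (s ∷ u) x ((p , q) ∷ wu) l V with act-word s x p (subst (s ≤_) (sym l) q) V (≤-reflexive l)
  ... | V₁ , a₁ , l₁ with run-word u (act s x) wu (trans (length-act s x) l) V₁
  ... | V₂ , e₂ , a₂ , l₂ = V₂ , e₂
      , ≈-trans a₂ (≈-trans (∼-++ʳ u a₁) (≡⇒∼ (++-assoc (word x) [ s ] u)))
      , ≤-trans l₂ (≤-trans (+-monoˡ-≤ (length u) l₁) (≤-reflexive (sym (+-suc _ (length u)))))

  normal : List ℕ → Code
  normal = run (identity n)

  normal-word : ∀ {u} → Word (WB n) u →
                Valid (normal u) × length (normal u) ≡ n × word (normal u) ∼ u × length (word (normal u)) ≤ length u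
  normal-word {u} wu with run-word u (identity n) wu (length-identity n) (identity-valid n)
  ... | V , e , p , l rewrite word-identity n = V , e , p , l

  act-identity-top : ∀ s k x → 1 ≤ s → s ≤ k → act s ((true , k) ∷ x) ≡ (true , k) ∷ act s x
  act-identity-top 1 (suc k) x p q = refl
  act-identity-top (suc (suc j)) k x p q = act-above q

  run-identity-top : ∀ u k x → All (λ s → 1 ≤ s × s ≤ k) u → run ((true , k) ∷ x) u ≡ (true , k) ∷ run x u
  run-identity-top [] k x [] = refl
  run-identity-top (s ∷ u) k x ((p , q) ∷ wu) = trans (cong (λ y → run y u) (act-identity-top s k x p q))
      (run-identity-top u k (act s x) wu)

  run-descend : ∀ c v x → run ((true , c + v) ∷ x) (descend c v) ≡ (true , v) ∷ x
  run-descend zero    v x = refl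
  run-descend (suc c) v x = trans (cong (λ y → run y (descend c v)) (act-next (c + v))) (run-descend c v x)

  run-ascend : ∀ v a x → run ((false , a) ∷ x) (ascend (2 + a) v) ≡ (false , a + v) ∷ x
  run-ascend zero    a x = cong (λ z → (false , z) ∷ x) (sym (+-identityʳ a))
  run-ascend (suc v) a x = trans (cong (λ y → run y (ascend (3 + a) v)) (act-self a))
    (trans (run-ascend v (suc a) x) (cong (λ z → (false , z) ∷ x) (sym (+-suc a v))))

  run-coset : ∀ k b v x → v ≤ k → run ((true , k) ∷ x) (coset k b v) ≡ (b , v) ∷ x
  run-coset k true  v x h = trans (cong (λ z → run ((true , z) ∷ x) (coset k true v)) (sym (m∸n+n≡m h)))
      (run-descend (k ∸ v) v x)
  run-coset k false v x h = trans (run-++ _ (descend k 0) _)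
    (trans (cong (λ y → run y (1 ∷ ascend 2 v)) (trans (cong (λ z → run ((true , z) ∷ x) (descend k 0))
        (sym (+-identityʳ k))) (run-descend k 0 x)))
    (run-ascend v 0 x))

  word-letters : ∀ x → Valid x → All (λ s → 1 ≤ s × s ≤ length x) (word x)
  word-letters [] V = []
  word-letters ((b , v) ∷ x) (h , V) = All.++⁺ (All.map (λ (p , q) → p , ≤-trans q (n≤1+n _))
      (word-letters x V)) (letters b)
    where
    down : ∀ c w → c + w ≤ length x → All (λ s → 1 ≤ s × s ≤ suc (length x)) (descend c w)
    down c w l = All.zipWith (λ (p , q) → ≤-trans (s≤s z≤n) p , ≤-trans q (s≤s l)) (descend-≥ c w , descend-≤ c w)
    letters : ∀ b → All (λ s → 1 ≤ s × s ≤ suc (length x)) (coset (length x) b v)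
    letters true  = down _ v (≤-reflexive (m∸n+n≡m h))
    letters false = All.++⁺ (down _ 0 (≤-reflexive (+-identityʳ _))) ((s≤s z≤n , s≤s z≤n) ∷
      All.zipWith (λ (p , q) → ≤-trans (s≤s z≤n) p , ≤-trans (≤-pred q) (s≤s h)) (ascend-≥ 2 v , ascend-< 2 v))

  run-word-identity : ∀ x → Valid x → run (identity (length x)) (word x) ≡ x
  run-word-identity [] V = refl
  run-word-identity ((b , v) ∷ x) (h , V) = trans (run-++ _ (word x) _)
    (trans (cong (λ y → run y (coset (length x) b v))
      (trans (run-identity-top (word x) (length x) _ (word-letters x V)) (cong (_ ∷_) (run-word-identity x V))))
    (run-coset (length x) b v x h))

  word-Word : ∀ x → Valid x → length x ≡ n → Word (WB n) (word x)
  word-Word x V refl = word-letters x V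

  normal-of-word : ∀ x → Valid x → length x ≡ n → normal (word x) ≡ x
  normal-of-word x V refl = run-word-identity x V

  -- Every word of the same element also runs to `x`, and each of its letters adds at most one to
  -- the length of the current normal word.
  word-reduced : ∀ x → Valid x → length x ≡ n → Reduced (WB n) (word x)
  word-reduced x V e v wv p =
    subst (λ y → length (word y) ≤ length v)
      (trans (run-∼ p (identity n)) (normal-of-word x V e)) (proj₂ (proj₂ (proj₂ (normal-word wv))))

  reduced-word : ∀ {w} → Word (WB n) w → Σ (List ℕ) λ a → Word (WB n) a × a ∼ w × Reduced (WB n) a
  reduced-word {w} ww with normal-word ww
  ... | V , e , p , _ = word (normal w) , word-Word _ V e , p , word-reduced _ V e

-- Sparse codes: elements whose reduced words are all commutation equivalent.

-- The elements of ⟨ s₁ , s₂ ⟩ other than the longest one.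
data Dihedral : Code → Set where
  d₀   : Dihedral ((true  , 1) ∷ (true  , 0) ∷ [])
  d₁   : Dihedral ((true  , 1) ∷ (false , 0) ∷ [])
  d₂   : Dihedral ((true  , 0) ∷ (true  , 0) ∷ [])
  d₁₂  : Dihedral ((true  , 0) ∷ (false , 0) ∷ [])
  d₂₁  : Dihedral ((false , 0) ∷ (true  , 0) ∷ [])
  d₁₂₁ : Dihedral ((false , 0) ∷ (false , 0) ∷ [])
  d₂₁₂ : Dihedral ((false , 1) ∷ (true  , 0) ∷ [])

-- The top level is the trivial coset and contributes no letter to `word`.
Idle : Code → Set
Idle []            = ⊥
Idle ((b , v) ∷ x) = b ≡ true × v ≡ length x

-- Levels above 2 carry at most the single letter of that level, and no two adjacent ones do.
data Sparse : Code → Set where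
  base : ∀ {x} → Dihedral x → Sparse x
  idle : ∀ {x k} → length x ≡ k → Sparse x → Sparse ((true , k) ∷ x)
  on   : ∀ {x k} → length x ≡ suc k → Sparse x → Idle x → Sparse ((true , k) ∷ x)

sparse-length : ∀ {x} → Sparse x → 2 ≤ length x
sparse-length (base d₀)   = ≤-refl
sparse-length (base d₁)   = ≤-refl
sparse-length (base d₂)   = ≤-refl
sparse-length (base d₁₂)  = ≤-refl
sparse-length (base d₂₁)  = ≤-refl
sparse-length (base d₁₂₁) = ≤-refl
sparse-length (base d₂₁₂) = ≤-refl
sparse-length (idle _ f)  = ≤-trans (sparse-length f) (n≤1+n _)
sparse-length (on _ f _)  = ≤-trans (sparse-length f) (n≤1+n _)

sparse-valid : ∀ {x} → Sparse x → Valid x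
sparse-valid (base d₀)   = ≤-refl , ≤-refl , tt
sparse-valid (base d₁)   = ≤-refl , ≤-refl , tt
sparse-valid (base d₂)   = z≤n , ≤-refl , tt
sparse-valid (base d₁₂)  = z≤n , ≤-refl , tt
sparse-valid (base d₂₁)  = z≤n , ≤-refl , tt
sparse-valid (base d₁₂₁) = z≤n , ≤-refl , tt
sparse-valid (base d₂₁₂) = ≤-refl , ≤-refl , tt
sparse-valid (idle e f)  = ≤-reflexive (sym e) , sparse-valid f
sparse-valid (on e f _)  = ≤-trans (n≤1+n _) (≤-reflexive (sym e)) , sparse-valid f

word-idle : ∀ {x k} → length x ≡ k → word ((true , k) ∷ x) ≡ word x
word-idle {x} refl rewrite n∸n≡0 (length x) = ++-identityʳ (word x)

word-on : ∀ {x k} → length x ≡ suc k → word ((true , k) ∷ x) ≡ word x ++ [ 2 + k ]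
word-on {x} {k} e rewrite e = cong (word x ++_) (trans (coset-pos (≤-refl {suc k}))
    (cong (λ c → descend c (suc k) ++ [ 2 + k ]) (n∸n≡0 (suc k))))

word-next : ∀ {x k} → suc k ≤ length x → word (act (2 + k) ((true , suc k) ∷ x)) ≡ word
    ((true , suc k) ∷ x) ++ [ 2 + k ]
word-next {x} {k} l = trans (cong word (act-next {true} {x} k))
  (trans (cong (word x ++_) (coset-pos l)) (sym (++-assoc (word x) _ _)))

not-shorter : ∀ {u : List ℕ} v {w} → w ≡ u ++ v → ¬ (length w < length u)
not-shorter {u} v refl l = 1+n≰n (≤-trans (s≤s (≤-trans (m≤m+n (length u) (length v))
    (≤-reflexive (sym (length-++ u))))) l)

AllPairs-remove : ∀ {R : ℕ → ℕ → Set} u {k v} → AllPairs R (u ++ k ∷ v) →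
                  AllPairs R (u ++ v) × All (λ x → R x k) u × All (R k) v
AllPairs-remove []      (p ∷ ps) = ps , [] , p
AllPairs-remove (x ∷ u) (p ∷ ps) with AllPairs-remove u ps | All.++⁻ u p
... | qs , q , r | pu , (pk ∷ pv) = (All.++⁺ pu pv ∷ qs) , pk ∷ q , r

Commuting : List ℕ → Set
Commuting = AllPairs (λ a b → mB a b ≡ 2)

module Sparseness (n : ℕ) where
  open TypeB n

  -- The middle component preserves the side condition of `on` when a descent takes place below it.
  Descends : ℕ → Code → Set
  Descends s x = Sparse (act s x) × (Idle x → Idle (act s x)) × word (act s x) ++ [ s ] ∼c word x

  -- Each of the seven elements has a single reduced word, so its only possible descent is the last
  -- letter of that word.
  dihedral-descent : ∀ {s x} → Dihedral x → 1 ≤ s → s ≤ 2 → length (word (act s x)) < length (word x) → Descends s x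
  dihedral-descent {1} d₀   _ _ ()
  dihedral-descent {2} d₀   _ _ ()
  dihedral-descent {1} d₁   _ _ _ = base d₀ , (λ i → i) , c-refl
  dihedral-descent {2} d₁   _ _ (s≤s ())
  dihedral-descent {1} d₂   _ _ (s≤s ())
  dihedral-descent {2} d₂   _ _ _ = base d₀ , (λ { (_ , ()) }) , c-refl
  dihedral-descent {1} d₁₂  _ _ (s≤s (s≤s ()))
  dihedral-descent {2} d₁₂  _ _ _ = base d₁ , (λ { (_ , ()) }) , c-refl
  dihedral-descent {1} d₂₁  _ _ _ = base d₂ , (λ { () }) , c-refl
  dihedral-descent {2} d₂₁  _ _ (s≤s (s≤s ()))
  dihedral-descent {1} d₁₂₁ _ _ _ = base d₁₂ , (λ { () }) , c-refl
  dihedral-descent {2} d₁₂₁ _ _ (s≤s (s≤s (s≤s ())))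
  dihedral-descent {1} d₂₁₂ _ _ (s≤s (s≤s (s≤s ())))
  dihedral-descent {2} d₂₁₂ _ _ _ = base d₂₁ , (λ { () }) , c-refl
  dihedral-descent {suc (suc (suc _))} _ _ (s≤s (s≤s ()))

  dihedral-length : ∀ {x} → Dihedral x → length x ≡ 2
  dihedral-length d₀   = refl
  dihedral-length d₁   = refl
  dihedral-length d₂   = refl
  dihedral-length d₁₂  = refl
  dihedral-length d₂₁  = refl
  dihedral-length d₁₂₁ = refl
  dihedral-length d₂₁₂ = refl

  -- At an `on` level with letter `2 + k`, a descent is this letter or is at most `k` and commutes
  -- with it, since `1 + k` would lengthen the word. At an idle level the letter of that level would
  -- lengthen it.
  sparse-descent : ∀ {s x} → Sparse x → 1 ≤ s → s ≤ length x →
                   length (word (act s x)) < length (word x) → Descends s x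
  sparse-descent (base d) p q l = dihedral-descent d p (≤-trans q (≤-reflexive (dihedral-length d))) l
  sparse-descent {s} (idle {x} {k} e f) p q l with m≤n⇒m<n∨m≡n (≤-trans q (s≤s (≤-reflexive e)))
  ... | inj₁ (s≤s q′) rewrite act-identity-top s k x p q′ | word-idle {act s x}
      (trans (length-act s x) e) | word-idle {x} e
    with sparse-descent f p (≤-trans q′ (≤-reflexive (sym e))) l
  ...   | f′ , _ , c = idle (trans (length-act s x) e) f′ , (λ { (h , h′) → h , trans h′ (sym (length-act s x)) }) , c
  sparse-descent (idle {x} {zero} e f) p q l | inj₂ refl with subst (2 ≤_) e (sparse-length f)
  ... | ()
  sparse-descent (idle {x} {suc k} e f) p q l | inj₂ refl =
    ⊥-elim (not-shorter [ 2 + k ] (word-next (≤-reflexive (sym e))) l)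
  sparse-descent {s} (on {x} {k} e f i) p q l with m≤n⇒m<n∨m≡n (≤-trans q (s≤s (≤-reflexive e)))
  ... | inj₂ refl rewrite act-self {true} {x} k | word-idle {x} e | word-on {x} e =
    idle e f , (λ { (_ , h) → ⊥-elim (1+n≢n (sym (trans h e))) }) , c-refl
  ... | inj₁ (s≤s q′) with m≤n⇒m<n∨m≡n q′
  ...   | inj₁ (s≤s q″) rewrite act-identity-top s k x p q″ | word-on {x} e | word-on {act s x}
      (trans (length-act s x) e)
    with sparse-descent f p (≤-trans q′ (≤-reflexive (sym e))) (shrink (word x) (word (act s x)) l)
    where
    shrink : ∀ u v → length (v ++ [ 2 + k ]) < length (u ++ [ 2 + k ]) → length v < length u
    shrink u v l = ≤-pred (subst₂ (λ a b → suc a ≤ b) (trans (length-++ v) (+-comm _ 1))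
        (trans (length-++ u) (+-comm _ 1)) l)
  ...     | f′ , h , c = on (trans (length-act s x) e) f′ (h i) , (λ { (_ , h) → ⊥-elim (1+n≢n (sym (trans h e))) })
    , c-trans (≡⇒∼c (++-assoc (word (act s x)) [ 2 + k ] [ s ]))
      (c-trans (c-swap (word (act s x)) [] (mB-far′ (s≤s (s≤s q″))))
      (c-trans (≡⇒∼c (sym (++-assoc (word (act s x)) [ s ] [ 2 + k ]))) (∼c-++ʳ [ 2 + k ] c)))
  sparse-descent (on {x} {zero} e f i) p q l | inj₁ _ | inj₂ refl with subst (2 ≤_) e (sparse-length f)
  ... | s≤s ()
  sparse-descent (on {x} {suc k} e f i) p q l | inj₁ _ | inj₂ refl =
    ⊥-elim (not-shorter [ 2 + k ] (word-next (≤-trans (n≤1+n _) (≤-reflexive (sym e)))) l)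

  reduced-init : ∀ {a s} → Gen (WB n) s → Reduced (WB n) (a ++ [ s ]) → Reduced (WB n) a
  reduced-init {a} {s} gs r v wv p = ≤-pred (subst₂ _≤_ (trans (length-++ a) (+-comm _ 1))
      (trans (length-++ v) (+-comm _ 1))
    (r (v ++ [ s ]) (All.++⁺ wv (gs ∷ [])) (∼-++ʳ [ s ] p)))

  sparse-reduced : ∀ {x} → Sparse x → length x ≡ n → Reduced (WB n) (word x)
  sparse-reduced f e = word-reduced _ (sparse-valid f) e

  -- Induction on the length `l`: the last letter `s` of `a` is a descent, the rest of `a` is a
  -- reduced word of `act s x`, and that code is sparse again.
  sparse-unique : ∀ {x} l a → length a ≡ l → Sparse x → length x ≡ n → Word (WB n) a → Reduced
      (WB n) a → a ∼ word x → a ∼c word x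
  sparse-unique {x} l a la f e wa r p with initLast a
  sparse-unique {x} l .[] la f e wa r p | [] with word x | same-length wa (word-Word x (sparse-valid f) e) r
      (sparse-reduced f e) p
  ... | [] | _ = c-refl
  sparse-unique {x} zero .(a ∷ʳ s) la f e wa r p | a ∷ʳ′ s with trans (sym (trans (length-++ a) (+-comm _ 1))) la
  ... | ()
  sparse-unique {x} (suc l) .(a ∷ʳ s) la f e wa r p | a ∷ʳ′ s with All.++⁻ a wa
  ... | wa′ , ((gs , gs′) ∷ []) =
    let V = sparse-valid f
        s≤ = subst (s ≤_) (sym e) gs′
        (V′ , act∼ , _) = act-word s x gs s≤ V (≤-reflexive e)
        e′ = trans (length-act s x) e
        ra = reduced-init (gs , gs′) r
        a∼ : a ∼ word (act s x)
        a∼ = ≈-trans (≈-trans (≡⇒∼ (sym (++-identityʳ a))) (≈-trans (≈-sym (≈-cancel a [] (gs , gs′)))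
            (≡⇒∼ (sym (++-assoc a [ s ] [ s ])))))
               (≈-trans (∼-++ʳ [ s ] p) (≈-sym act∼))
        len-a = trans (length-++ a) (+-comm (length a) 1)
        len : length (word (act s x)) < length (word x)
        len = ≤-reflexive (trans (cong suc (sym (same-length wa′ (word-Word _ V′ e′) ra (word-reduced _ V′ e′) a∼)))
                (trans (sym len-a) (same-length wa (word-Word x V e) r (sparse-reduced f e) p)))
        (f′ , _ , c) = sparse-descent f gs s≤ len
    in c-trans (∼c-++ʳ [ s ] (sparse-unique l a (suc-injective (trans (sym len-a) la)) f′ e′ wa′ ra a∼)) c

  sparse-FC : ∀ {x} → Sparse x → length x ≡ n → FullyCommutative (WB n) (word x)
  sparse-FC f e a b wa wb pa pb ra rb =
    c-trans (sparse-unique _ a refl f e wa ra pa) (c-sym (sparse-unique _ b refl f e wb rb pb))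

  Commuting-remove : ∀ u {k v} → Commuting (u ++ k ∷ v) → Commuting (u ++ v) × All (λ x → mB x k ≡ 2) (u ++ v)
  Commuting-remove u {k} c with AllPairs-remove u c
  ... | c′ , p , q = c′ , All.++⁺ p (All.map (λ {x} → trans (mB-sym x k)) q)

  -- The largest possible letter, if present, is pulled to the end of `u`. Its lower neighbour is
  -- then absent, so the level beneath is idle, as `on` requires. The hypothesis on 3 says the same
  -- at the border to the dihedral part.
  build : ∀ {d} → Dihedral d → ∀ i u → Commuting u → All (λ s → 3 ≤ s × s ≤ 2 + i) u → (3 ∈ u → Idle d) →
          Σ Code λ x → length x ≡ 2 + i × Sparse x × word x ∼c word d ++ u × (2 + i ∉ u → (i ≡ 0 → Idle d) → Idle x)
  build {d} D zero [] c b h = d , dihedral-length D , base D , ≡⇒∼c (sym (++-identityʳ (word d))) , λ _ g → g refl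
  build D zero (s ∷ u) c ((p , q) ∷ b) h = ⊥-elim (1+n≰n (≤-trans p q))
  build {d} D (suc i) u c b h with 3 + i ∈? u
  ... | no  k∉ with build D i u c (All.tabulate (λ {s} s∈ → proj₁ (All.lookup b s∈) , bound s∈
      (proj₂ (All.lookup b s∈)))) h
    where
    bound : ∀ {s} → s ∈ u → s ≤ 3 + i → s ≤ 2 + i
    bound s∈ l with m≤n⇒m<n∨m≡n l
    ... | inj₁ l′   = ≤-pred l′
    ... | inj₂ refl = ⊥-elim (k∉ s∈)
  ...   | x , e , f , w , _ = (true , 2 + i) ∷ x , cong suc e , idle e f , c-trans
      (≡⇒∼c (word-idle {x} e)) w , λ _ _ → refl , sym e
  build {d} D (suc i) u c b h | yes k∈ with ∈-∃++ k∈
  ... | u₁ , u₂ , refl with Commuting-remove u₁ c | All.++⁻ u₁ b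
  ... | c′ , far | b₁ , (_ ∷ b₂) with build D i (u₁ ++ u₂) c′ (All.zipWith bound (far , All.++⁺ b₁ b₂))
      (λ 3∈ → h (weaken 3∈))
    where
    bound : ∀ {s} → mB s (3 + i) ≡ 2 × 3 ≤ s × s ≤ 3 + i → 3 ≤ s × s ≤ 2 + i
    bound (m , p , q) with m≤n⇒m<n∨m≡n q
    ... | inj₁ l    = p , ≤-pred l
    ... | inj₂ refl with trans (sym m) (mB-diag (3 + i))
    ...   | ()
    weaken : ∀ {s} → s ∈ u₁ ++ u₂ → s ∈ u₁ ++ (3 + i) ∷ u₂
    weaken s∈ with ∈-++⁻ u₁ s∈
    ... | inj₁ q = ∈-++⁺ˡ q
    ... | inj₂ q = ∈-++⁺ʳ u₁ (there q)
  ...   | x , e , f , w , g = (true , suc i) ∷ x , cong suc e , on e f (g not-in (λ { refl → h k∈ }))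
    , c-trans (≡⇒∼c (word-on {x} e)) (c-trans (∼c-++ʳ [ 3 + i ] w)
        (c-trans (≡⇒∼c (trans (++-assoc (word d) (u₁ ++ u₂) _) (cong (word d ++_) (++-assoc u₁ u₂ _))))
          (∼c-++ˡ (word d) (∼c-++ˡ u₁ (c-trans (∼c-pass [] (All.++⁻ʳ u₁ far))
              (≡⇒∼c (cong (3 + i ∷_) (++-identityʳ u₂))))))))
    , λ k∉ _ → ⊥-elim (k∉ k∈)
    where
    not-in : 2 + i ∉ u₁ ++ u₂
    not-in q with trans (sym (All.lookup far q)) (mB-next i)
    ... | ()

  Represented : List ℕ → Set
  Represented u = Σ Code λ x → length x ≡ n × Sparse x × word x ∼c u

  build′ : 2 ≤ n → ∀ {d} → Dihedral d → ∀ {u} → CommProd (WB n) u → All (3 ≤_) u →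
      (3 ∈ u → Idle d) → Represented (word d ++ u)
  build′ (s≤s (s≤s {n = i} _)) D {u} (wu , c) b h with build D i u c (All.zipWith (λ (p , _ , q) → p , q) (b , wu)) h
  ... | x , e , f , w , _ = x , e , f , w

  ≥3 : ∀ {s} → 1 ≤ s → s ≢ 1 → s ≢ 2 → 3 ≤ s
  ≥3 {suc zero}          _ p q = ⊥-elim (p refl)
  ≥3 {suc (suc zero)}    _ p q = ⊥-elim (q refl)
  ≥3 {suc (suc (suc s))} _ p q = s≤s (s≤s (s≤s z≤n))

  -- The letters 1 and 2 do not both occur, so the dihedral part is `d₀`, `d₁` or `d₂`. The last of
  -- these is not idle, but 2 excludes 3.
  CommProd-represented : 2 ≤ n → ∀ {u} → CommProd (WB n) u → Represented u
  CommProd-represented le {u} (wu , c) with 2 ∈? u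
  ... | yes 2∈ with ∈-∃++ 2∈
  ...   | u₁ , u₂ , refl with Commuting-remove u₁ c | All.++⁻ u₁ wu
  ...     | c′ , far | w₁ , (_ ∷ w₂) with build′ le d₂ {u₁ ++ u₂} (All.++⁺ w₁ w₂ , c′)
                (All.zipWith (λ ((p , _) , m) → ≥3 p (λ { refl → bad m }) (λ { refl → bad′ m })) (All.++⁺ w₁ w₂ , far))
                (λ 3∈ → ⊥-elim (bad″ (All.lookup far 3∈)))
    where
    bad : mB 1 2 ≢ 2
    bad ()
    bad′ : mB 2 2 ≢ 2
    bad′ ()
    bad″ : mB 3 2 ≢ 2
    bad″ ()
  ...       | x , e , f , w = x , e , f , c-trans w (c-sym (∼c-pass u₂ (All.++⁻ˡ u₁ far)))
  CommProd-represented le {u} (wu , c) | no 2∉ with 1 ∈? u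
  ... | no 1∉ = build′ le d₀ (wu , c) (All.tabulate (λ s∈ → ≥3 (proj₁ (All.lookup wu s∈)) (λ { refl → 1∉ s∈ })
      (λ { refl → 2∉ s∈ }))) (λ _ → refl , refl)
  ... | yes 1∈ with ∈-∃++ 1∈
  ...   | u₁ , u₂ , refl with Commuting-remove u₁ c | All.++⁻ u₁ wu
  ...     | c′ , far | w₁ , (_ ∷ w₂) with build′ le d₁ {u₁ ++ u₂} (All.++⁺ w₁ w₂ , c′)
                (All.zipWith (λ ((p , _) , m) → ≥3 p (λ { refl → bad m }) (λ { refl → bad′ m })) (All.++⁺ w₁ w₂ , far))
                (λ _ → refl , refl)
    where
    bad : mB 1 1 ≢ 2
    bad ()
    bad′ : mB 2 1 ≢ 2
    bad′ ()
  ...       | x , e , f , w = x , e , f , c-trans w (c-sym (∼c-pass u₂ (All.++⁻ˡ u₁ far)))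

  Represented⇒Reduced : ∀ {u} → Represented u → Reduced (WB n) u
  Represented⇒Reduced (x , e , f , w) = reduced-≤ (sparse-reduced f e) (∼c⇒∼ (word-Word x (sparse-valid f) e) w)
      (≤-reflexive (Perm.↭-length (∼c⇒↭ (c-sym w))))

  Represented⇒FC : ∀ {u} → Represented u → FullyCommutative (WB n) u
  Represented⇒FC (x , e , f , w) = FC-resp (∼c⇒∼ (word-Word x (sparse-valid f) e) w) (sparse-FC f e)

-- Occurrences of letters in a word.

first-occurrence : ∀ {i} y → i ∈ y → ∃₂ λ y₁ y₂ → y ≡ y₁ ++ i ∷ y₂ × i ∉ y₁
first-occurrence {i} (x ∷ y) i∈ with i ≟ x | i∈
... | yes refl | _        = [] , y , refl , λ ()
... | no  i≢   | here e   = ⊥-elim (i≢ e)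
... | no  i≢   | there i∈′ with first-occurrence y i∈′
...   | y₁ , y₂ , refl , i∉ = x ∷ y₁ , y₂ , refl , λ { (here e) → i≢ e ; (there p) → i∉ p }

last-occurrence : ∀ {i} y → i ∈ y → ∃₂ λ y₁ y₂ → y ≡ y₁ ++ i ∷ y₂ × i ∉ y₂
last-occurrence {i} (x ∷ y) i∈ with i ∈? y | i∈
... | yes i∈′ | _ with last-occurrence y i∈′
...   | y₁ , y₂ , refl , i∉ = x ∷ y₁ , y₂ , refl , i∉
last-occurrence (x ∷ y) i∈ | no i∉ | here refl = [] , y , refl , i∉
last-occurrence (x ∷ y) i∈ | no i∉ | there i∈′ = ⊥-elim (i∉ i∈′)

module _ {i : ℕ} where
  ∉ˡ : ∀ {x y} → i ∉ x ++ y → i ∉ x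
  ∉ˡ i∉ p = i∉ (∈-++⁺ˡ p)

  ∉ʳ : ∀ x {y} → i ∉ x ++ y → i ∉ y
  ∉ʳ x i∉ p = i∉ (∈-++⁺ʳ x p)

  ∉-tail : ∀ x {k y} → i ∉ x ++ k ∷ y → i ∉ y
  ∉-tail x i∉ p = i∉ (∈-++⁺ʳ x (there p))

  ∉-++ : ∀ x {y} → i ∉ x → i ∉ y → i ∉ x ++ y
  ∉-++ x p q h with ∈-++⁻ x h
  ... | inj₁ h = p h
  ... | inj₂ h = q h

  ∉-reverse : ∀ {x} → i ∉ x → i ∉ reverse x
  ∉-reverse i∉ p = i∉ (Any.reverse⁻ p)

≥4 : ∀ {s} → 1 ≤ s → s ≢ 1 → s ≢ 2 → s ≢ 3 → 4 ≤ s
≥4 {1} _ p _ _ = ⊥-elim (p refl)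
≥4 {2} _ _ p _ = ⊥-elim (p refl)
≥4 {3} _ _ _ p = ⊥-elim (p refl)
≥4 {suc (suc (suc (suc _)))} _ _ _ _ = s≤s (s≤s (s≤s (s≤s z≤n)))

reverse-split : ∀ p (i : ℕ) r → reverse (p ++ i ∷ r) ≡ reverse r ++ i ∷ reverse p
reverse-split p i r = trans (reverse-++ p (i ∷ r)) (trans (cong (_++ reverse p) (unfold-reverse i r))
    (++-assoc (reverse r) [ i ] (reverse p)))

AllPairs-splits : ∀ {R : ℕ → ℕ → Set} a → (∀ p {i q j} → a ≡ p ++ i ∷ q → j ∈ q → R i j) → AllPairs R a
AllPairs-splits []      h = []
AllPairs-splits (x ∷ a) h = All.tabulate (h [] refl) ∷ AllPairs-splits a (λ p e → h (x ∷ p) (cong (x ∷_) e))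

-- Alternation of neighbouring letters in left irreducible words.

module Heaps (n : ℕ) where
  open TypeB n

  Far : ℕ → List ℕ → Set
  Far g = All (λ x → mB x g ≡ 2)

  far : ∀ {i y} → i ∉ y → suc i ∉ y → suc (suc i) ∉ y → Far (suc i) y
  far {i} p q r = All.tabulate (λ {x} x∈ → mB-distant i x (λ { refl → p x∈ }) (λ { refl → q x∈ }) (λ { refl → r x∈ }))

  two-to-front : ∀ {s t} p q {r} → Far s p → Far t p → Far t q → p ++ s ∷ q ++ t ∷ r ∼c s ∷ t ∷ p ++ q ++ r
  two-to-front {s} {t} p q {r} a b c = c-trans (∼c-pass (q ++ t ∷ r) a) (∼c-∷ s
    (c-trans (∼c-++ˡ p (∼c-pass r c)) (∼c-pass (q ++ r) b)))

  three-to-front : ∀ {s t} p q u {r} → Far s p → Far t p → Far t q → Far s q → Far s u →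
                   p ++ s ∷ q ++ t ∷ u ++ s ∷ r ∼c s ∷ t ∷ s ∷ p ++ q ++ u ++ r
  three-to-front {s} {t} p q u {r} a b c d e = c-trans (two-to-front p q a b c) (∼c-∷ s (∼c-∷ t
    (c-trans (∼c-++ˡ p (∼c-++ˡ q (∼c-pass r e))) (c-trans (∼c-++ˡ p (∼c-pass (u ++ r) d)) (∼c-pass (q ++ u ++ r) a)))))

  gather : ∀ {s t} p q u {r} → Far s q → Far s u → p ++ s ∷ q ++ t ∷ u ++ s ∷ r ∼c (p ++ q) ++ s ∷ t ∷ s ∷ u ++ r
  gather {s} {t} p q u {r} d e = c-trans (∼c-++ˡ p (c-sym (∼c-pass (t ∷ u ++ s ∷ r) d)))
    (c-trans (∼c-++ˡ p (∼c-++ˡ q (∼c-∷ s (∼c-∷ t (∼c-pass r e))))) (≡⇒∼c (sym (++-assoc p q _))))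

  assoc₂ : ∀ p (x : ℕ) y z → (p ++ x ∷ y) ++ z ≡ p ++ x ∷ y ++ z
  assoc₂ p x y z = ++-assoc p (x ∷ y) z

  module Irreducible {a : List ℕ} (irr : LeftIrreducible a) where
    open LeftIrreducible irr renaming (word to a-word)

    no-braid₃ : ∀ {s t} x y → mB s t ≡ 3 → ¬ (a ∼c x ++ s ∷ t ∷ s ∷ y)
    no-braid₃ {s} {t} x y e p = no-braid s t x y (≤-reflexive (sym e))
        (subst (λ k → a ∼c x ++ alt (WB n) s t k ++ y) (sym e) p)

    no-braid₄ : ∀ {s t} x y → mB s t ≡ 4 → ¬ (a ∼c x ++ s ∷ t ∷ s ∷ t ∷ y)
    no-braid₄ {s} {t} x y e p = no-braid s t x y (≤-trans (n≤1+n 3) (≤-reflexive (sym e)))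
        (subst (λ k → a ∼c x ++ alt (WB n) s t k ++ y) (sym e) p)

    no-start₃ : ∀ {s t y} → mB s t ≡ 3 → ¬ (a ∼c s ∷ t ∷ y)
    no-start₃ {s} {t} {y} e p = no-start s t y (≤-reflexive (sym e))
        (subst (λ k → a ∼c alt (WB n) s t (k ∸ 1) ++ y) (sym e) p)

    no-start₄ : ∀ {s t y} → mB s t ≡ 4 → ¬ (a ∼c s ∷ t ∷ s ∷ y)
    no-start₄ {s} {t} {y} e p = no-start s t y (≤-trans (n≤1+n 3) (≤-reflexive (sym e)))
        (subst (λ k → a ∼c alt (WB n) s t (k ∸ 1) ++ y) (sym e) p)

    bounded : ∀ {i} → i ∈ a → 1 ≤ i × i ≤ n
    bounded = All.lookup a-word

    at : ∀ {i r} p → a ≡ p ++ i ∷ r → i ∈ a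
    at p e = subst (_ ∈_) (sym e) (∈-++⁺ʳ p (here refl))

    0∉ : 0 ∉ a
    0∉ p with proj₁ (bounded p)
    ... | ()

    Separates : ℕ → ℕ → Set
    Separates j i = ∀ p y r → a ≡ p ++ i ∷ y ++ i ∷ r → j ∉ y → ⊥

    consecutive : ∀ {i j} → (∀ p y r → a ≡ p ++ i ∷ y ++ i ∷ r → i ∉ y → j ∉ y → ⊥) → Separates j i
    consecutive {i} h p y r e j∉ with i ∈? y
    ... | no i∉  = h p y r e i∉ j∉
    ... | yes i∈ with first-occurrence y i∈
    ...   | y₁ , y₂ , refl , i∉ = h p y₁ (y₂ ++ i ∷ r) (trans e (cong (λ z → p ++ i ∷ z) (assoc₂ y₁ i y₂ _))) i∉ (∉ˡ j∉)

    not-adjacent : ∀ {i} p y r → a ≡ p ++ i ∷ y ++ i ∷ r → ¬ Far i y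
    not-adjacent {i} p y r e f = no-square i (p ++ y) r
      (c-trans (≡⇒∼c e) (c-trans (∼c-++ˡ p (c-sym (∼c-pass (i ∷ r) f))) (≡⇒∼c (sym (++-assoc p y _)))))

    -- By the hypothesis on `Far`, only `j` can keep the two `i` apart. No `j` in `y` gives a
    -- square, a single one gives the braid i j i, and two of them would enclose an `i`.
    pinch : ∀ {i j} p y r → a ≡ p ++ i ∷ y ++ i ∷ r → i ∉ y →
        (∀ {z} → i ∉ z → j ∉ z → (∀ {x} → x ∈ z → x ∈ y) → Far i z) →
            Separates i j → mB i j ≡ 3 → ⊥
    pinch {i} {j} p y r e i∉ f sep m with j ∈? y
    ... | no j∉  = not-adjacent p y r e (f i∉ j∉ (λ q → q))
    ... | yes j∈ with first-occurrence y j∈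
    ...   | y₁ , y₂ , refl , j∉₁ with j ∈? y₂
    ...     | no j∉₂ = no-braid₃ (p ++ y₁) (y₂ ++ r) m (c-trans
        (≡⇒∼c (trans e (cong (λ z → p ++ i ∷ z) (assoc₂ y₁ j y₂ _))))
                (gather p y₁ y₂ (f (∉ˡ i∉) j∉₁ ∈-++⁺ˡ) (f (∉-tail y₁ i∉) j∉₂ (λ q → ∈-++⁺ʳ y₁ (there q)))))
    ...     | yes j∈₂ with first-occurrence y₂ j∈₂
    ...       | y₃ , y₄ , refl , _ = sep (p ++ i ∷ y₁) y₃ (y₄ ++ i ∷ r)
                (trans e (trans (cong (λ z → p ++ i ∷ z) (trans (assoc₂ y₁ j _ _)
                    (cong (λ z → y₁ ++ j ∷ z) (assoc₂ y₃ j y₄ _)))) (sym (assoc₂ p i y₁ _))))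
                (λ q → i∉ (∈-++⁺ʳ y₁ (there (∈-++⁺ˡ q))))

    private
      step-down : ∀ d i → n < 2 + i + suc d → n < 3 + i + d
      step-down d i = subst (n <_) (cong (2 +_) (+-suc i d))

      too-large : ∀ i {p r} → n < 2 + i + 0 → a ≡ p ++ 2 + i ∷ r → ⊥
      too-large i {p} l e = 1+n≰n (≤-trans (subst (n <_) (cong (2 +_) (+-identityʳ i)) l) (proj₂ (bounded (at p e))))

    -- `d` is the fuel of a descending induction that starts at letters beyond `n`, which do not
    -- occur.
    lower-separates′ : ∀ d i → n < 2 + i + d → Separates (1 + i) (2 + i)
    lower-separates′ zero    i l p y r e _ = too-large i l e
    lower-separates′ (suc d) i l = consecutive (λ p y r e i∉ j∉ →
      pinch p y r e i∉ (λ i∉z u∉z ⊆y → far (λ q → j∉ (⊆y q)) i∉z u∉z)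
          (lower-separates′ d (suc i) (step-down d i l)) (mB-next i))

    lower-separates : ∀ i → Separates (1 + i) (2 + i)
    lower-separates i = lower-separates′ n i (s≤s (≤-trans (m≤n+m n i) (n≤1+n _)))

    -- In other words, this `2 + i` is a minimal element of the heap. By induction the first `3 + i`
    -- of `p` would be minimal too, and moving it and then `2 + i` to the front would give a
    -- forbidden start.
    first-is-minimal′ : ∀ d i → n < 2 + i + d → ∀ p r → a ≡ p ++ 2 + i ∷ r → 1 + i ∉ p → 2 + i ∉ p → 3 + i ∉ p
    first-is-minimal′ zero    i l p r e _ _ _ = too-large i l e
    first-is-minimal′ (suc d) i l p r e l∉ i∉ u∈ with first-occurrence p u∈
    ... | p₁ , p₂ , refl , u∉₁ = no-start₃ (mB-prev i) (c-trans (≡⇒∼c e′) (two-to-front p₁ p₂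
            (far (∉ˡ i∉) u∉₁ (first-is-minimal′ d (suc i) (step-down d i l) p₁ _ e′ (∉ˡ i∉) u∉₁))
            (far (∉ˡ l∉) (∉ˡ i∉) u∉₁) (far (∉-tail p₁ l∉) (∉-tail p₁ i∉) u∉₂)))
      where
      e′ = trans e (assoc₂ p₁ (3 + i) p₂ _)
      u∉₂ : 3 + i ∉ p₂
      u∉₂ q with first-occurrence p₂ q
      ... | p₃ , p₄ , refl , _ = lower-separates (suc i) p₁ p₃ _
          (trans e′ (cong (λ z → p₁ ++ 3 + i ∷ z) (assoc₂ p₃ (3 + i) p₄ _)))
              (λ q → i∉ (∈-++⁺ʳ p₁ (there (∈-++⁺ˡ q))))

    first-is-minimal : ∀ i p r → a ≡ p ++ 2 + i ∷ r → 1 + i ∉ p → 2 + i ∉ p → 3 + i ∉ p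
    first-is-minimal i = first-is-minimal′ n i (s≤s (≤-trans (m≤n+m n i) (n≤1+n _)))

    ∉-prefix : ∀ {i p r} → i ∉ a → a ≡ p ++ r → i ∉ p
    ∉-prefix i∉ refl = ∉ˡ i∉

    upper-separates : ∀ i → Separates (2 + i) (1 + i)
    upper-separates zero = consecutive (λ p y r e i∉ j∉ → not-adjacent p y r e
        (far (∉ˡ (∉-tail p (subst (0 ∉_) e 0∉))) i∉ j∉))
    upper-separates (suc zero) = consecutive core
      where
      core : ∀ p y r → a ≡ p ++ 2 ∷ y ++ 2 ∷ r → 2 ∉ y → 3 ∉ y → ⊥
      core p y r e 2∉ 3∉ with 1 ∈? y
      ... | no 1∉  = lower-separates 0 p y r e 1∉
      ... | yes 1∈ with first-occurrence y 1∈
      ...   | y₁ , y₂ , refl , 1∉₁ = before (1 ∈? p)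
        where
        e₁ : a ≡ p ++ 2 ∷ y₁ ++ 1 ∷ y₂ ++ 2 ∷ r
        e₁ = trans e (cong (λ z → p ++ 2 ∷ z) (assoc₂ y₁ 1 y₂ _))
        1∉₂ : 1 ∉ y₂
        1∉₂ q with first-occurrence y₂ q
        ... | y₃ , y₄ , refl , _ = upper-separates 0 (p ++ 2 ∷ y₁) y₃ _
                (trans e₁ (trans (cong (λ z → p ++ 2 ∷ y₁ ++ 1 ∷ z) (assoc₂ y₃ 1 y₄ _)) (sym (assoc₂ p 2 y₁ _))))
                (λ q → 2∉ (∈-++⁺ʳ y₁ (there (∈-++⁺ˡ q))))
        0∉p : 0 ∉ p
        0∉p = ∉-prefix 0∉ e
        0∉y : 0 ∉ y₁ ++ 1 ∷ y₂
        0∉y = ∉ˡ (∉-tail p (subst (0 ∉_) e 0∉))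
        f₁ = far (∉ˡ 0∉y) 1∉₁ (∉ˡ 2∉)
        f₂ = far 1∉₁ (∉ˡ 2∉) (∉ˡ 3∉)
        f₂′ = far 1∉₂ (∉-tail y₁ 2∉) (∉-tail y₁ 3∉)
        -- Exactly one 1 lies between the two 2s. With no 1 before them, 2 1 2 moves to the front, a
        -- braid lacking one letter. Otherwise the last 1 before them completes the braid 1 2 1 2.
        before : Dec (1 ∈ p) → ⊥
        before (no 1∉p) = no-start₄ {2} {1} refl (c-trans (≡⇒∼c e₁) (three-to-front p y₁ y₂
            (far 1∉p 2∉p (first-is-minimal 0 p _ e 1∉p 2∉p)) (far 0∉p 1∉p 2∉p) f₁ f₂ f₂′))
          where
          2∉p : 2 ∉ p
          2∉p q with last-occurrence p q
          ... | p₁ , p₂ , refl , _ = lower-separates 0 p₁ p₂ _ (trans e (assoc₂ p₁ 2 p₂ _)) (∉-tail p₁ 1∉p)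
        before (yes 1∈p) with last-occurrence p 1∈p
        ... | p₁ , p₂ , refl , 1∉p₂ = no-braid₄ {1} {2} (p₁ ++ p₂) (y₁ ++ y₂ ++ r) refl
              (c-trans (≡⇒∼c (trans e₁ (assoc₂ p₁ 1 p₂ _)))
              (c-trans (∼c-++ˡ p₁ (c-trans (c-sym (∼c-pass _ (far (∉-tail p₁ 0∉p) 1∉p₂ 2∉p₂)))
                (∼c-++ˡ p₂ (∼c-∷ 1 (∼c-∷ 2 (c-trans (∼c-pass _ f₁)
                    (∼c-∷ 1 (c-trans (∼c-++ˡ y₁ (∼c-pass r f₂′)) (∼c-pass (y₂ ++ r) f₂)))))))))
              (≡⇒∼c (sym (++-assoc p₁ p₂ _)))))
          where
          2∉p₂ : 2 ∉ p₂
          2∉p₂ q with last-occurrence p₂ q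
          ... | p₃ , p₄ , refl , _ = lower-separates 0 (p₁ ++ 1 ∷ p₃) p₄ _
                  (trans e (trans (assoc₂ p₁ 1 _ _) (trans (cong (λ z → p₁ ++ 1 ∷ z) (assoc₂ p₃ 2 p₄ _))
                      (sym (assoc₂ p₁ 1 p₃ _)))))
                  (∉-tail p₃ 1∉p₂)
    upper-separates (suc (suc j)) = consecutive (λ p y r e i∉ u∉ →
      pinch p y r e i∉ (λ i∉z l∉z ⊆y → far l∉z i∉z (λ q → u∉ (⊆y q))) (upper-separates (suc j)) (mB-prev j))

    Avoids : ℕ → List ℕ → Set
    Avoids j t = 1 + j ∉ t × 2 + j ∉ t × 3 + j ∉ t

    no-zigzag₁ : ∀ t r q p → a ≡ t ++ 1 ∷ r ++ 2 ∷ q ++ 1 ∷ p → Avoids 0 t → Avoids 0 r → 1 ∉ q → ⊥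
    no-zigzag₁ t r q p e (1∉t , 2∉t , 3∉t) (1∉r , 2∉r , 3∉r) 1∉q =
      no-start₄ {1} {2} refl (c-trans (≡⇒∼c e) (three-to-front t r q
        (far (∉-prefix 0∉ e) 1∉t 2∉t) (far 1∉t 2∉t 3∉t) (far 1∉r 2∉r 3∉r)
        (far (∉ˡ (∉-tail t 0∉′)) 1∉r 2∉r) (far (∉ˡ (∉-tail r (∉-tail t 0∉′))) 1∉q 2∉q)))
      where
      0∉′ = subst (0 ∉_) e 0∉
      2∉q : 2 ∉ q
      2∉q h with first-occurrence q h
      ... | q₁ , q₂ , refl , _ = lower-separates 0 (t ++ 1 ∷ r) q₁ _
              (trans e (trans (cong (λ z → t ++ 1 ∷ r ++ 2 ∷ z) (assoc₂ q₁ 2 q₂ _)) (sym (assoc₂ t 1 r _)))) (∉ˡ 1∉q)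

    -- The first 1 + j has a j on its left, by no-start₃, and another j before the second 1 + j, by
    -- lower-separates: the configuration recurs one step lower, ending in an initial 1 2 1.
    no-zigzag : ∀ j t r q p → a ≡ t ++ 1 + j ∷ r ++ 2 + j ∷ q ++ 1 + j ∷ p → Avoids j t → Avoids j r → ⊥
    no-zigzag zero t r q p e ∉t ∉r with 1 ∈? q
    ... | no 1∉q = no-zigzag₁ t r q p e ∉t ∉r 1∉q
    ... | yes 1∈q with first-occurrence q 1∈q
    ...   | q₁ , q₂ , refl , 1∉q₁ =
      no-zigzag₁ t r q₁ _ (trans e (cong (λ z → t ++ 1 ∷ r ++ 2 ∷ z) (assoc₂ q₁ 1 q₂ _))) ∉t ∉r 1∉q₁
    no-zigzag (suc j) t r q p e (i∉t , u∉t , v∉t) (i∉r , u∉r , v∉r) with 1 + j ∈? t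
    ... | no l∉t = no-start₃ (mB-next j) (c-trans (≡⇒∼c e) (two-to-front t r (far l∉t i∉t u∉t) (far i∉t u∉t v∉t)
        (far i∉r u∉r v∉r)))
    ... | yes l∈t with last-occurrence t l∈t
    ...   | t₁ , t₂ , refl , l∉t₂ with 1 + j ∈? r ++ 3 + j ∷ q
    ...     | no l∉ = lower-separates j t (r ++ 3 + j ∷ q) p (trans e
        (cong (λ z → t ++ 2 + j ∷ z) (sym (assoc₂ r (3 + j) q _)))) l∉
    ...     | yes l∈ with ∈-∃++ l∈
    ...       | P , Q , eq = no-zigzag j t₁ t₂ P _
                (trans e (trans (assoc₂ t₁ (1 + j) t₂ _) (cong (λ z → t₁ ++ 1 + j ∷ t₂ ++ 2 + j ∷ z)
                  (trans (sym (assoc₂ r (3 + j) q _)) (trans (cong (_++ 2 + j ∷ p) eq) (assoc₂ P (1 + j) Q _))))))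
                (l∉t₁ , ∉ˡ i∉t , ∉ˡ u∉t) (l∉t₂ , ∉-tail t₁ i∉t , ∉-tail t₁ u∉t)
      where
      l∉t₁ : 1 + j ∉ t₁
      l∉t₁ h with last-occurrence t₁ h
      ... | t₃ , t₄ , refl , _ = upper-separates j t₃ t₄ _
              (trans e (trans (assoc₂ (t₃ ++ 1 + j ∷ t₄) (1 + j) t₂ _) (assoc₂ t₃ (1 + j) t₄ _))) (∉-tail t₃ (∉ˡ i∉t))

    once : ∀ {i} p r → a ≡ p ++ 1 + i ∷ r → (2 + i ∉ p → 1 + i ∉ p) × (2 + i ∉ r → 1 + i ∉ r)
    once {i} p r e = left , right
      where
      left : 2 + i ∉ p → 1 + i ∉ p
      left u∉ h with last-occurrence p h
      ... | x , y , refl , _ = upper-separates i x y r (trans e (assoc₂ x (1 + i) y _)) (∉-tail x u∉)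
      right : 2 + i ∉ r → 1 + i ∉ r
      right u∉ h with first-occurrence r h
      ... | x , y , refl , _ = upper-separates i p x y e (∉ˡ u∉)

  -- Words irreducible on both sides.

  module TwoSided {a : List ℕ} (irr : LeftIrreducible a) (irr′ : LeftIrreducible (reverse a)) where
    open Irreducible irr

    -- Both `2 + i` and `3 + i` occur once, and the position of `1 + i` decides. If none precedes
    -- `2 + i`, the word can start with `2 + i`, `3 + i`. If one precedes and one follows, there is
    -- a zigzag. If none follows, the reversed word can start with `3 + i`, `2 + i`.
    no-neighbour-before-top : ∀ i t p → a ≡ t ++ 3 + i ∷ p → 4 + i ∉ a → 2 + i ∈ t → 2 + i ∉ p → ⊥
    no-neighbour-before-top i t p e top j∈t j∉p with last-occurrence t j∈t
    ... | t₂ , t₁ , refl , j∉t₁ = before (1 + i ∈? t₂)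
      where
      k-once = once t p e
      k∉t = proj₁ k-once (∉-prefix top e)
      k∉p = proj₂ k-once (∉-tail t (subst (4 + i ∉_) e top))
      e₁ : a ≡ t₂ ++ 2 + i ∷ t₁ ++ 3 + i ∷ p
      e₁ = trans e (assoc₂ t₂ (2 + i) t₁ _)
      j∉t₂ : 2 + i ∉ t₂
      j∉t₂ = proj₁ (once t₂ _ e₁) (∉ˡ k∉t)
      u∉t = ∉-prefix top e
      u∉p : 4 + i ∉ p
      u∉p = ∉-tail t (subst (4 + i ∉_) e top)
      before : Dec (1 + i ∈ t₂) → ⊥
      before (no l∉t₂) = no-start₃ (mB-next i) (c-trans (≡⇒∼c e₁) (two-to-front t₂ t₁ (far l∉t₂ j∉t₂ (∉ˡ k∉t))
        (far j∉t₂ (∉ˡ k∉t) (∉ˡ u∉t)) (far j∉t₁ (∉-tail t₂ k∉t) (∉-tail t₂ u∉t))))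
      before (yes l∈t₂) with last-occurrence t₂ l∈t₂ | 1 + i ∈? t₁ ++ 3 + i ∷ p
      ... | u₂ , u₁ , refl , l∉u₁ | yes l∈ with ∈-∃++ l∈
      ...   | P , Q , eq = no-zigzag i u₂ u₁ P Q e₂
              (proj₁ (once u₂ _ e₂) (∉ˡ j∉t₂) , ∉ˡ j∉t₂ , ∉ˡ (∉ˡ k∉t)) (l∉u₁ , ∉-tail u₂ j∉t₂ , ∉-tail u₂ (∉ˡ k∉t))
        where
        e₂ : a ≡ u₂ ++ 1 + i ∷ u₁ ++ 2 + i ∷ P ++ 1 + i ∷ Q
        e₂ = trans e₁ (trans (assoc₂ u₂ (1 + i) u₁ _) (cong (λ z → u₂ ++ 1 + i ∷ u₁ ++ 2 + i ∷ z) eq))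
      before (yes l∈t₂) | u₂ , u₁ , refl , l∉u₁ | no l∉ = Irreducible.no-start₃ irr′ (mB-prev i)
        (c-trans (≡⇒∼c (trans (cong reverse e₁) (trans (reverse-split t₂ (2 + i) _)
            (trans (cong (_++ 2 + i ∷ reverse t₂) (reverse-split t₁ (3 + i) p))
            (assoc₂ (reverse p) (3 + i) (reverse t₁) _)))))
          (two-to-front (reverse p) (reverse t₁)
            (far (∉-reverse j∉p) (∉-reverse k∉p) (∉-reverse u∉p))
            (far (∉-reverse (∉-tail t₁ l∉)) (∉-reverse j∉p) (∉-reverse k∉p))
            (far (∉-reverse (∉ˡ {x = t₁} l∉)) (∉-reverse j∉t₁) (∉-reverse (∉-tail t₂ k∉t)))))

  module Classification {a : List ℕ} (irr : LeftIrreducible a) (irr′ : LeftIrreducible (reverse a)) where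
    open LeftIrreducible irr using () renaming (word to a-word)
    open Irreducible irr
    open TwoSided using (no-neighbour-before-top)

    reverse²-irr : LeftIrreducible (reverse (reverse a))
    reverse²-irr = subst LeftIrreducible (sym (reverse-involutive a)) irr

    -- A neighbour on one side only is the previous situation, read forwards or backwards.
    -- Neighbours on both sides form a zigzag at once.
    top-isolated : ∀ i → 3 + i ∈ a → 2 + i ∈ a → 4 + i ∉ a → ⊥
    top-isolated i k∈ j∈ top with ∈-∃++ k∈
    ... | p , t , e = cases (2 + i ∈? p) (2 + i ∈? t)
      where
      k-once = once p t e
      k∉p = proj₁ k-once (∉-prefix top e)
      k∉t = proj₂ k-once (∉-tail p (subst (4 + i ∉_) e top))
      cases : Dec (2 + i ∈ p) → Dec (2 + i ∈ t) → ⊥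
      cases (no j∉p) (no j∉t) with ∈-++⁻ p (subst (2 + i ∈_) e j∈)
      ... | inj₁ h         = j∉p h
      ... | inj₂ (there h) = j∉t h
      ... | inj₂ (here h)  = 1+n≢n (sym h)
      cases (yes j∈p) (no j∉t) = no-neighbour-before-top irr irr′ i p t e top j∈p j∉t
      cases (no j∉p) (yes j∈t) = no-neighbour-before-top irr′ reverse²-irr i (reverse t) (reverse p)
        (trans (cong reverse e) (reverse-split p (3 + i) t)) (∉-reverse top) (Any.reverse⁺ j∈t) (∉-reverse j∉p)
      cases (yes j∈p) (yes j∈t) with last-occurrence p j∈p | ∈-∃++ j∈t
      ... | P , Q , refl , j∉Q | t₁ , t₂ , refl = no-zigzag (suc i) P Q t₁ t₂ e′
            (proj₁ (once P _ e′) (∉ˡ k∉p) , ∉ˡ k∉p , ∉ˡ u∉p) (j∉Q , ∉-tail P k∉p , ∉-tail P u∉p)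
        where
        e′ = trans e (assoc₂ P (2 + i) Q _)
        u∉p = ∉-prefix top e

    not-both : ∀ d i → n < 2 + i + d → 2 + i ∈ a → 3 + i ∈ a → ⊥
    not-both zero    i l j∈ k∈ = 1+n≰n (≤-trans (subst (n <_) (cong (2 +_) (+-identityʳ i)) l) (proj₂ (bounded j∈)))
    not-both (suc d) i l j∈ k∈ with 4 + i ∈? a
    ... | no top = top-isolated i k∈ j∈ top
    ... | yes u∈ = not-both d (suc i) (subst (n <_) (cong (2 +_) (+-suc i d)) l) k∈ u∈

    no-adjacent : ∀ i → 2 + i ∈ a → 3 + i ∈ a → ⊥
    no-adjacent i = not-both n i (s≤s (≤-trans (m≤n+m n i) (n≤1+n _)))

    -- The exceptional alternative records a letter 1 or 2 and the presence of both in `a`. It is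
    -- refuted when 1 or 2 is missing from `a`, and also in a sublist from which both have been
    -- removed.
    Mild : ℕ → ℕ → Set
    Mild i j = mB i j ≡ 2 ⊎ ((i ≡ 1 ⊎ i ≡ 2) × 1 ∈ a × 2 ∈ a)

    repeated : ∀ {i j} p {q} → a ≡ p ++ i ∷ q → i ∈ q → Separates j i → j ∈ a
    repeated {i} {j} p e i∈ sep with ∈-∃++ i∈
    ... | x , y , refl with j ∈? x
    ...   | no j∉  = ⊥-elim (sep p x y e j∉)
    ...   | yes j∈ = subst (j ∈_) (sym e) (∈-++⁺ʳ p (there (∈-++⁺ˡ j∈)))

    mild-pairs : AllPairs Mild a
    mild-pairs = AllPairs-splits a pair
      where
      pair : ∀ p {i q j} → a ≡ p ++ i ∷ q → j ∈ q → Mild i j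
      pair p {i} {q} {j} e j∈ with proximity i j | at p e | subst (j ∈_) (sym e) (∈-++⁺ʳ p (there j∈))
      ... | far> l | _ | _ = inj₁ (mB-far l)
      ... | far< l | _ | _ = inj₁ (mB-far′ l)
      pair p {zero}              e j∈ | same | i∈ | _ = ⊥-elim (0∉ i∈)
      pair p {suc zero}          e j∈ | same | i∈ | _ = inj₂ (inj₁ refl , i∈ , repeated p e j∈ (upper-separates 0))
      pair p {suc (suc zero)}    e j∈ | same | i∈ | _ = inj₂ (inj₂ refl , repeated p e j∈ (lower-separates 0) , i∈)
      pair p {suc (suc (suc i))} e j∈ | same | i∈ | _ = ⊥-elim
          (no-adjacent i (repeated p e j∈ (lower-separates (suc i))) i∈)
      pair p {zero}              e j∈ | next | i∈ | _   = ⊥-elim (0∉ i∈)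
      pair p {suc zero}          e j∈ | next | i∈ | j∈a = inj₂ (inj₁ refl , i∈ , j∈a)
      pair p {suc (suc i)}       e j∈ | next | i∈ | j∈a = ⊥-elim (no-adjacent i i∈ j∈a)
      pair p {j = zero}          e j∈ | prev | i∈ | j∈a = ⊥-elim (0∉ j∈a)
      pair p {j = suc zero}      e j∈ | prev | i∈ | j∈a = inj₂ (inj₂ refl , j∈a , i∈)
      pair p {j = suc (suc i)}   e j∈ | prev | i∈ | j∈a = ⊥-elim (no-adjacent i j∈a i∈)

    Tail : List ℕ → Set
    Tail u = CommProd (WB n) u × All (4 ≤_) u

    data Shape : Set where
      commuting : Commuting a → Shape
      one-two   : ∀ u → Tail u → a ∼c 1 ∷ 2 ∷ u → Shape
      two-one   : ∀ u → Tail u → a ∼c 2 ∷ 1 ∷ u → Shape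

    tail : ∀ {s t u} → a ∼c s ∷ t ∷ u → AllPairs Mild u → 1 ∉ u → 2 ∉ u → 3 ∉ u → Tail u
    tail p c 1∉ 2∉ 3∉ with ∼c-Word p a-word
    ... | _ ∷ _ ∷ wu = (wu , mild c 1∉ 2∉) , All.tabulate (λ s∈ → ≥4 (proj₁ (All.lookup wu s∈))
              (λ { refl → 1∉ s∈ }) (λ { refl → 2∉ s∈ }) (λ { refl → 3∉ s∈ }))
      where
      mild : ∀ {u} → AllPairs Mild u → 1 ∉ u → 2 ∉ u → Commuting u
      mild []       _  _  = []
      mild (m ∷ ms) 1∉ 2∉ = All.map (λ { (inj₁ e) → e ; (inj₂ (inj₁ refl , _)) → ⊥-elim (1∉ (here refl)) ;
          (inj₂ (inj₂ refl , _)) → ⊥-elim (2∉ (here refl)) }) m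
        ∷ mild ms (λ q → 1∉ (there q)) (λ q → 2∉ (there q))

    shape : Shape
    shape with 1 ∈? a | 2 ∈? a
    ... | no 1∉  | _ = commuting (AllPairs.map (λ { (inj₁ e) → e ; (inj₂ (_ , 1∈ , _)) → ⊥-elim (1∉ 1∈) }) mild-pairs)
    ... | yes _  | no 2∉ = commuting (AllPairs.map (λ { (inj₁ e) → e ; (inj₂ (_ , _ , 2∈)) → ⊥-elim
        (2∉ 2∈) }) mild-pairs)
    ... | yes 1∈ | yes 2∈ with ∈-∃++ 2∈
    ...   | p , t , e = cases (1 ∈? p) (1 ∈? t)
      where
      3∉ : 3 ∉ a
      3∉ = no-adjacent 0 2∈
      3∉p = ∉-prefix 3∉ e
      3∉t = ∉-tail p (subst (3 ∉_) e 3∉)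
      2∉p = proj₁ (once p t e) 3∉p
      2∉t = proj₂ (once p t e) 3∉t
      0∉p = ∉-prefix 0∉ e
      0∉t = ∉-tail p (subst (0 ∉_) e 0∉)
      -- Without 3 the letter 2 occurs once, so only the side on which 1 occurs matters. If it
      -- occurs on both sides, 1 2 1 can be moved to the front.
      cases : Dec (1 ∈ p) → Dec (1 ∈ t) → Shape
      cases (no 1∉p) (no 1∉t) with ∈-++⁻ p (subst (1 ∈_) e 1∈)
      ... | inj₁ h         = ⊥-elim (1∉p h)
      ... | inj₂ (there h) = ⊥-elim (1∉t h)
      cases (yes 1∈p) (no 1∉t) with last-occurrence p 1∈p
      ... | P , Q , refl , 1∉Q = one-two (P ++ Q ++ t) (tail c mild (∉-++ P 1∉P (∉-++ Q 1∉Q 1∉t))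
              (∉-++ P (∉ˡ 2∉p) (∉-++ Q (∉-tail P 2∉p) 2∉t)) (∉-++ P (∉ˡ 3∉p) (∉-++ Q (∉-tail P 3∉p) 3∉t))) c
        where
        e′ = trans e (assoc₂ P 1 Q _)
        1∉P = proj₁ (once P _ e′) (∉ˡ 2∉p)
        c = c-trans (≡⇒∼c e′) (two-to-front P Q (far (∉ˡ 0∉p) 1∉P (∉ˡ 2∉p)) (far 1∉P (∉ˡ 2∉p) (∉ˡ 3∉p))
            (far 1∉Q (∉-tail P 2∉p) (∉-tail P 3∉p)))
        mild : AllPairs Mild (P ++ Q ++ t)
        mild = subst (AllPairs Mild) (++-assoc P Q t) (proj₁ (AllPairs-remove (P ++ Q)
          (subst (AllPairs Mild) (sym (++-assoc P Q (2 ∷ t)))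
              (proj₁ (AllPairs-remove P (subst (AllPairs Mild) e′ mild-pairs))))))
      cases (no 1∉p) (yes 1∈t) with first-occurrence t 1∈t
      ... | P , Q , refl , 1∉P = two-one (p ++ P ++ Q) (tail c mild (∉-++ p 1∉p (∉-++ P 1∉P 1∉Q))
              (∉-++ p 2∉p (∉-++ P (∉ˡ 2∉t) (∉-tail P 2∉t))) (∉-++ p 3∉p (∉-++ P (∉ˡ 3∉t) (∉-tail P 3∉t)))) c
        where
        1∉Q = proj₂ (once (p ++ 2 ∷ P) Q (trans e (sym (assoc₂ p 2 P _)))) (∉-tail P 2∉t)
        c = c-trans (≡⇒∼c e) (two-to-front p P (far 1∉p 2∉p 3∉p) (far 0∉p 1∉p 2∉p) (far (∉ˡ 0∉t) 1∉P (∉ˡ 2∉t)))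
        mild : AllPairs Mild (p ++ P ++ Q)
        mild = subst (AllPairs Mild) (++-assoc p P Q) (proj₁ (AllPairs-remove (p ++ P)
          (subst (AllPairs Mild) (sym (++-assoc p P (1 ∷ Q)))
              (proj₁ (AllPairs-remove p (subst (AllPairs Mild) e mild-pairs))))))
      cases (yes 1∈p) (yes 1∈t) with last-occurrence p 1∈p | first-occurrence t 1∈t
      ... | P , Q , refl , 1∉Q | T , T′ , refl , 1∉T = ⊥-elim (no-start₄ {1} {2} refl (c-trans (≡⇒∼c e′)
              (three-to-front P Q T (far (∉ˡ 0∉p) 1∉P (∉ˡ 2∉p)) (far 1∉P (∉ˡ 2∉p) (∉ˡ 3∉p))
                  (far 1∉Q (∉-tail P 2∉p) (∉-tail P 3∉p))
                (far (∉-tail P 0∉p) 1∉Q (∉-tail P 2∉p)) (far (∉ˡ 0∉t) 1∉T (∉ˡ 2∉t)))))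
        where
        e′ = trans e (assoc₂ P 1 Q _)
        1∉P = proj₁ (once P _ e′) (∉ˡ 2∉p)

-- Transport along isomorphisms of Coxeter systems.

record Hom (C D : CoxSys) (f : List ℕ → List ℕ) : Set where
  field
    hom-word   : ∀ {w} → Word C w → Word D (f w)
    hom-≈      : ∀ {u v} → _≈_ C u v → _≈_ D (f u) (f v)
    -- `≈c` also swaps letters that are no generators, and a relabelling need not respect `m` on
    -- those.
    hom-≈c     : ∀ {u v} → Word C u → _≈c_ C u v → _≈c_ D (f u) (f v)
    hom-length : ∀ w → length (f w) ≡ length w
open Hom

-- One map serves both directions because reversal and i ↦ n + 2 - i are involutions. `f` need not
-- be multiplicative, which lets reversal in.
record Iso (C D : CoxSys) (f : List ℕ → List ℕ) : Set where
  field
    to       : Hom C D f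
    from     : Hom D C f
    to-from  : ∀ {w} → Word C w → f (f w) ≡ w
    from-to  : ∀ {w} → Word D w → f (f w) ≡ w
open Iso

Iso-sym : ∀ {C D f} → Iso C D f → Iso D C f
Iso-sym i = record { to = from i ; from = to i ; to-from = from-to i ; from-to = to-from i }

module _ {C D : CoxSys} {f : List ℕ → List ℕ} (i : Iso C D f) where
  iso-reduced : ∀ {w} → Word C w → Reduced C w → Reduced D (f w)
  iso-reduced {w} ww r v wv p = subst₂ _≤_ (sym (hom-length (to i) w)) (hom-length (from i) v)
    (r (f v) (hom-word (from i) wv) (subst (_≈_ C (f v)) (to-from i ww) (hom-≈ (from i) p)))

  iso-HasLength : ∀ {w k} → HasLength C w k → HasLength D (f w) k
  iso-HasLength (v , wv , p , r , e) =
    f v , hom-word (to i) wv , hom-≈ (to i) p , iso-reduced wv r , trans (hom-length (to i) v) e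

iso-FC : ∀ {C D f} (i : Iso C D f) {w} → Word C w → FullyCommutative C w → FullyCommutative D (f w)
iso-FC {C} {D} {f} i {w} ww fc a b wa wb pa pb ra rb = subst₂ (_≈c_ D) (from-to i wa) (from-to i wb)
  (hom-≈c (to i) (hom-word (from i) wa) (fc (f a) (f b) (hom-word (from i) wa) (hom-word (from i) wb)
    (back pa) (back pb) (iso-reduced (Iso-sym i) wa ra) (iso-reduced (Iso-sym i) wb rb)))
  where
  back : ∀ {x} → _≈_ D x (f w) → _≈_ C (f x) w
  back p = subst (_≈_ C _) (to-from i ww) (hom-≈ (from i) p)

iso-FC⁻ : ∀ {C D f} (i : Iso C D f) {w} → Word C w → FullyCommutative D (f w) → FullyCommutative C w
iso-FC⁻ {C} i ww fc = subst (FullyCommutative C) (to-from i ww) (iso-FC (Iso-sym i) (hom-word (to i) ww) fc)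

iso-InSupp : ∀ {C D f} (i : Iso C D f) {s s′ w} → (∀ {v} → s ∈ v → s′ ∈ f v) → InSupp C s w → InSupp D s′ (f w)
iso-InSupp {f = f} i h (v , wv , p , r , s∈) = f v , hom-word (to i) wv , hom-≈ (to i) p , iso-reduced i wv r , h s∈

-- Reversal of words.

module Reversal (C : CoxSys) where
  open Coxeter C

  private
    -- `end k s t` is the last letter of `alt C s t (suc k)`.
    end : ℕ → ℕ → ℕ → ℕ
    end zero    s t = s
    end (suc k) s t = end k t s

    alt-snoc : ∀ k s t → alt C s t (suc k) ≡ alt C s t k ++ [ end k s t ]
    alt-snoc zero    s t = refl
    alt-snoc (suc k) s t = cong (s ∷_) (alt-snoc k t s)

    end-end : ∀ k s t → end k (end k s t) (end k t s) ≡ s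
    end-end zero    s t = refl
    end-end (suc k) s t = end-end k s t

    reverse-alt′ : ∀ k s t → reverse (alt C s t (suc k)) ≡ alt C (end k s t) (end k t s) (suc k)
    reverse-alt′ zero    s t = refl
    reverse-alt′ (suc k) s t = trans (unfold-reverse s (alt C t s (suc k)))
      (trans (cong (_++ [ s ]) (reverse-alt′ k t s))
      (trans (cong (λ x → alt C (end k t s) (end k s t) (suc k) ++ [ x ]) (sym (end-end k s t)))
      (sym (alt-snoc (suc k) (end k t s) (end k s t)))))

    end-cases : ∀ k → (∀ s t → end k s t ≡ s) ⊎ (∀ s t → end k s t ≡ t)
    end-cases zero = inj₁ (λ s t → refl)
    end-cases (suc k) with end-cases k
    ... | inj₁ h = inj₂ (λ s t → h t s)
    ... | inj₂ h = inj₁ (λ s t → h t s)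

  -- Which alternative holds depends on the parity of `k` alone. Hence both sides of a braid
  -- relation are treated alike by reversal.
  reverse-alt : ∀ k → (∀ s t → reverse (alt C s t k) ≡ alt C s t k) ⊎ (∀ s t → reverse (alt C s t k) ≡ alt C t s k)
  reverse-alt zero = inj₁ (λ s t → refl)
  reverse-alt (suc k) with end-cases k
  ... | inj₁ h = inj₁ (λ s t → trans (reverse-alt′ k s t) (cong₂ (λ a b → alt C a b (suc k)) (h s t) (h t s)))
  ... | inj₂ h = inj₂ (λ s t → trans (reverse-alt′ k s t) (cong₂ (λ a b → alt C a b (suc k)) (h s t) (h t s)))

  reverse-++₃ : ∀ (u x v : List ℕ) → reverse (u ++ x ++ v) ≡ reverse v ++ reverse x ++ reverse u
  reverse-++₃ u x v = trans (reverse-++ u (x ++ v)) (trans (cong (_++ reverse u) (reverse-++ x v))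
      (++-assoc (reverse v) (reverse x) (reverse u)))

  reverse-∼ : ∀ {u v} → u ∼ v → reverse u ∼ reverse v
  reverse-∼ ≈-refl        = ≈-refl
  reverse-∼ (≈-sym p)     = ≈-sym (reverse-∼ p)
  reverse-∼ (≈-trans p q) = ≈-trans (reverse-∼ p) (reverse-∼ q)
  reverse-∼ (≈-cancel {s} u v g) =
    subst₂ _∼_ (sym (reverse-++₃ u (s ∷ s ∷ []) v)) (sym (reverse-++ u v)) (≈-cancel (reverse v) (reverse u) g)
  reverse-∼ (≈-braid {s} {t} u v g h) = subst₂ _∼_ (sym (reverse-++₃ u _ v)) (sym (reverse-++₃ u _ v))
      (turn (reverse-alt (m s t)))
    where
    U = reverse u
    V = reverse v
    turn : _ → V ++ reverse (alt C s t (m s t)) ++ U ∼ V ++ reverse (alt C t s (m s t)) ++ U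
    turn (inj₁ e) = subst₂ (λ a b → V ++ a ++ U ∼ V ++ b ++ U) (sym (e s t)) (sym (e t s)) (≈-braid V U g h)
    turn (inj₂ e) = subst₂ (λ a b → V ++ a ++ U ∼ V ++ b ++ U) (sym (e s t)) (sym (e t s)) (≈-sym (≈-braid V U g h))

  reverse-∼c : (∀ s t → m s t ≡ m t s) → ∀ {u v} → u ∼c v → reverse u ∼c reverse v
  reverse-∼c m-sym c-refl        = c-refl
  reverse-∼c m-sym (c-sym p)     = c-sym (reverse-∼c m-sym p)
  reverse-∼c m-sym (c-trans p q) = c-trans (reverse-∼c m-sym p) (reverse-∼c m-sym q)
  reverse-∼c m-sym (c-swap {s} {t} u v e) =
    subst₂ _∼c_ (sym (reverse-++₃ u (s ∷ t ∷ []) v)) (sym (reverse-++₃ u (t ∷ s ∷ []) v))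
      (c-swap (reverse v) (reverse u) (trans (m-sym t s) e))

  reverse-Iso : (∀ s t → m s t ≡ m t s) → Iso C C reverse
  reverse-Iso m-sym = record { to = h ; from = h ; to-from = λ {w} _ → reverse-involutive w ; from-to = λ {w} _ → reverse-involutive w }
    where
    h : Hom C C reverse
    h = record
      { hom-word   = Perm.All-resp-↭ (↭-sym (Perm.↭-reverse _))
      ; hom-≈      = reverse-∼
      ; hom-≈c     = λ _ → reverse-∼c m-sym
      ; hom-length = length-reverse
      }

  module _ (m-sym : ∀ s t → m s t ≡ m t s) where
    private
      ι = reverse-Iso m-sym

    reverse-left : ∀ {s t w} → Word C w → LeftWeakStarReducible C s t w → RightWeakStarReducible C s t (reverse w)
    reverse-left {s} {t} {w} ww (gs , gt , l , (_ , _ , h₁ , h₂ , lt) , (_ , _ , h₃ , h₄ , lt′) , ¬fc) =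
      gs , gt , l
      , (_ , _ , flip∷ s w h₁ , iso-HasLength ι h₂ , lt)
      , (_ , _ , subst (λ z → HasLength C (z ++ [ t ]) _) (unfold-reverse s w)
          (flip∷ t (s ∷ w) h₃) , flip∷ s w h₄ , lt′)
      , λ fc → ¬fc (iso-FC⁻ ι (gt ∷ ww) (subst (FullyCommutative C) (sym (unfold-reverse t w)) fc))
      where
      flip∷ : ∀ s w {k} → HasLength C (s ∷ w) k → HasLength C (reverse w ++ [ s ]) k
      flip∷ s w h = subst (λ z → HasLength C z _) (unfold-reverse s w) (iso-HasLength ι h)

    reverse-right : ∀ {s t w} → Word C w → RightWeakStarReducible C s t w → LeftWeakStarReducible C s t (reverse w)
    reverse-right {s} {t} {w} ww (gs , gt , l , (_ , _ , h₁ , h₂ , lt) , (_ , _ , h₃ , h₄ , lt′) , ¬fc) =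
      gs , gt , l
      , (_ , _ , flip∷ʳ s w h₁ , iso-HasLength ι h₂ , lt)
      , (_ , _ , subst (λ z → HasLength C (t ∷ z) _) (reverse-++ w [ s ])
          (flip∷ʳ t (w ++ [ s ]) h₃) , flip∷ʳ s w h₄ , lt′)
      , λ fc → ¬fc (iso-FC⁻ ι (All.++⁺ ww (gt ∷ [])) (subst (FullyCommutative C) (sym (reverse-++ w [ t ])) fc))
      where
      flip∷ʳ : ∀ s w {k} → HasLength C (w ++ [ s ]) k → HasLength C (s ∷ reverse w) k
      flip∷ʳ s w h = subst (λ z → HasLength C z _) (reverse-++ w [ s ]) (iso-HasLength ι h)

-- The classification in type B.

Form : CoxSys → ℕ → ℕ → ℕ → List ℕ → Set
Form C a b c w =
    (Σ (List ℕ) λ u → CommProd C u × _≈_ C w u)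
  ⊎ (Σ (List ℕ) λ u → CommProd C u × ¬ InSupp C a u × ¬ InSupp C b u × ¬ InSupp C c u × _≈_ C w (a ∷ b ∷ u))
  ⊎ (Σ (List ℕ) λ u → CommProd C u × ¬ InSupp C a u × ¬ InSupp C b u × ¬ InSupp C c u × _≈_ C w (b ∷ a ∷ u))

module ClassificationB (n : ℕ) (n≥2 : 2 ≤ n) where
  open Sparseness n
  open TypeB n
  open Reversal (WB n)
  open Heaps.Classification n using (Shape; commuting; one-two; two-one; shape)

  private
    ι = reverse-Iso mB-sym

  -- `InSupp` admits any reduced word of `u`; by full commutativity each of them is a permutation of
  -- `u`.
  tail-avoids : ∀ {u i} → CommProd (WB n) u → All (4 ≤_) u → i ≤ 3 → ¬ InSupp (WB n) i u
  tail-avoids {u} {i} cu large i≤3 (v , wv , p , rv , i∈) =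
    1+n≰n (≤-trans (All.lookup large (Perm.∈-resp-↭ (∼c⇒↭ v∼cu) i∈)) i≤3)
    where
    rep = CommProd-represented n≥2 cu
    v∼cu : v ∼c u
    v∼cu = Represented⇒FC rep v u wv (proj₁ cu) p ≈-refl rv (Represented⇒Reduced rep)

  nonCancellable⇒form : ∀ w → Word (WB n) w → FullyCommutative (WB n) w → NonCancellable (WB n) w → Form (WB n) 1 2 3 w
  nonCancellable⇒form w ww fc (_ , irr) with reduced-word ww
  ... | a , wa , p , ra = conclude (shape
          (leftIrreducible fc (λ s t → proj₁ (irr s t)) wa p ra)
          (leftIrreducible (iso-FC ι ww fc) (λ s t red → proj₂ (irr s t)
              (subst (RightWeakStarReducible (WB n) s t) (reverse-involutive w)
              (reverse-left mB-sym (hom-word (to ι) ww) red)))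
            (hom-word (to ι) wa) (reverse-∼ p) (iso-reduced ι wa ra)))
    where
    conclude : Shape _ _ → Form (WB n) 1 2 3 w
    conclude (commuting c)               = inj₁ (a , (wa , c) , ≈-sym p)
    conclude (one-two u (cu , large) q)  = inj₂ (inj₁ (u , cu , tail-avoids cu large
        (s≤s z≤n) , tail-avoids cu large (s≤s (s≤s z≤n)) , tail-avoids cu large ≤-refl , ≈-trans (≈-sym p) (∼c⇒∼ wa q)))
    conclude (two-one u (cu , large) q)  = inj₂ (inj₂ (u , cu , tail-avoids cu large
        (s≤s z≤n) , tail-avoids cu large (s≤s (s≤s z≤n)) , tail-avoids cu large ≤-refl , ≈-trans (≈-sym p) (∼c⇒∼ wa q)))

  -- Treats `1 2 u` and `2 1 u` together; reversal interchanges them.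
  data Ends : ℕ → ℕ → Set where
    e₁₂ : Ends 1 2
    e₂₁ : Ends 2 1

  Ends-sym : ∀ {p q} → Ends p q → Ends q p
  Ends-sym e₁₂ = e₂₁
  Ends-sym e₂₁ = e₁₂

  data Form′ (w : List ℕ) : Set where
    commuting : ∀ {u} → CommProd (WB n) u → w ∼ u → Form′ w
    dihedral  : ∀ {p q u} → Ends p q → CommProd (WB n) u → All (4 ≤_) u → w ∼ p ∷ q ∷ u → Form′ w

  form⇒form′ : ∀ {w} → Form (WB n) 1 2 3 w → Form′ w
  form⇒form′ {w} (inj₁ (u , c , p)) = commuting c p
  form⇒form′ {w} (inj₂ h) = pair h
    where
    avoid : ∀ {u s} → CommProd (WB n) u → ¬ InSupp (WB n) s u → s ∉ u
    avoid {u} c h s∈ = h (u , proj₁ c , ≈-refl , Represented⇒Reduced (CommProd-represented n≥2 c) , s∈)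
    large : ∀ {u} → CommProd (WB n) u → ¬ InSupp (WB n) 1 u → ¬ InSupp (WB n) 2 u → ¬ InSupp (WB n) 3 u → All (4 ≤_) u
    large c h₁ h₂ h₃ = All.tabulate (λ {s} s∈ → ≥4 (proj₁ (All.lookup (proj₁ c) s∈))
        (λ { refl → avoid c h₁ s∈ }) (λ { refl → avoid c h₂ s∈ }) (λ { refl → avoid c h₃ s∈ }))
    pair : _ → Form′ w
    pair (inj₁ (u , c , h₁ , h₂ , h₃ , p)) = dihedral e₁₂ c (large c h₁ h₂ h₃) p
    pair (inj₂ (u , c , h₁ , h₂ , h₃ , p)) = dihedral e₂₁ c (large c h₁ h₂ h₃) p

  reverse-commuting : ∀ {u} → Commuting u → reverse u ∼c u
  reverse-commuting []            = c-refl
  reverse-commuting {x ∷ u} (e ∷ es) = c-trans (≡⇒∼c (unfold-reverse x u))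
      (c-trans (∼c-++ʳ [ x ] (reverse-commuting es))
    (c-trans (∼c-pass [] (All.map (λ {y} → trans (mB-sym y x)) e)) (≡⇒∼c (cong (x ∷_) (++-identityʳ u)))))

  end-gen : ∀ {p q} → Ends p q → Gen (WB n) p × Gen (WB n) q
  end-gen e₁₂ = (s≤s z≤n , ≤-trans (n≤1+n _) n≥2) , (s≤s z≤n , n≥2)
  end-gen e₂₁ = (s≤s z≤n , n≥2) , (s≤s z≤n , ≤-trans (n≤1+n _) n≥2)

  end≤2 : ∀ {p q} → Ends p q → p ≤ 2
  end≤2 e₁₂ = n≤1+n 1
  end≤2 e₂₁ = ≤-refl

  end-far : ∀ {p q s} → Ends p q → 4 ≤ s → mB s p ≡ 2
  end-far e l = mB-far′ (≤-trans (s≤s (s≤s (end≤2 e))) l)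

  reverse-form : ∀ {w} → Form′ w → Form′ (reverse w)
  reverse-form {w} (commuting {u} cu@(wu , c) p) =
    commuting cu (≈-trans (reverse-∼ p) (∼c⇒∼ (hom-word (to ι) wu) (reverse-commuting c)))
  reverse-form {w} (dihedral {p} {q} {u} e cu@(wu , c) large h) =
    dihedral (Ends-sym e) cu large (≈-trans (reverse-∼ h) (∼c⇒∼
        (hom-word (to ι) (proj₁ (end-gen e) ∷ proj₂ (end-gen e) ∷ wu))
      (c-trans (≡⇒∼c (trans (unfold-reverse p (q ∷ u)) (trans (cong (_++ [ p ]) (unfold-reverse q u))
          (++-assoc (reverse u) [ q ] [ p ]))))
      (c-trans (∼c-++ʳ (q ∷ p ∷ []) (reverse-commuting c))
      (c-trans (∼c-pass (p ∷ []) (All.map (end-far (Ends-sym e)) large))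
          (c-trans (∼c-∷ q (∼c-pass [] (All.map (end-far e) large)))
          (≡⇒∼c (cong (λ z → q ∷ p ∷ z) (++-identityʳ u)))))))))

  end₂-represented : ∀ {p q u} → Ends p q → CommProd (WB n) u → All (4 ≤_) u → Represented (p ∷ q ∷ u)
  end₂-represented e₁₂ cu large = build′ n≥2 d₁₂ cu (All.map (≤-trans (n≤1+n _)) large)
      (λ 3∈ → ⊥-elim (1+n≰n (All.lookup large 3∈)))
  end₂-represented e₂₁ cu large = build′ n≥2 d₂₁ cu (All.map (≤-trans (n≤1+n _)) large)
      (λ 3∈ → ⊥-elim (1+n≰n (All.lookup large 3∈)))

  end₃-represented : ∀ {p q u} → Ends p q → CommProd (WB n) u → All (4 ≤_) u → Represented (p ∷ q ∷ p ∷ u)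
  end₃-represented e₁₂ cu large = build′ n≥2 d₁₂₁ cu (All.map (≤-trans (n≤1+n _)) large)
      (λ 3∈ → ⊥-elim (1+n≰n (All.lookup large 3∈)))
  end₃-represented e₂₁ cu large = build′ n≥2 d₂₁₂ cu (All.map (≤-trans (n≤1+n _)) large)
      (λ 3∈ → ⊥-elim (1+n≰n (All.lookup large 3∈)))

  commuting-pair : ∀ {u s t} → Commuting u → s ∈ u → t ∈ u → ¬ (3 ≤ mB s t)
  commuting-pair {s = s} (e ∷ es) (here refl) (here refl) l = ≥3⇒distinct {s} {s} l refl
  commuting-pair (e ∷ es) (here refl) (there t∈)  l = ≥3⇒≢2 l (All.lookup e t∈)
  commuting-pair {s = s} {t} (e ∷ es) (there s∈) (here refl) l = ≥3⇒≢2 l (trans (mB-sym s t) (All.lookup e s∈))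
  commuting-pair (e ∷ es) (there s∈)  (there t∈)  l = commuting-pair es s∈ t∈ l

  -- By full commutativity the reduced word `s t v` rearranges the given form, so `s` and `t` are
  -- non-commuting letters of it. Only `p` and `q` qualify. For `s = p` the product `t w` is
  -- `q p q u`, which is fully commutative; for `s = q` the order of the two letters is wrong.
  not-left : ∀ {w} → Word (WB n) w → FullyCommutative (WB n) w → Form′ w → ∀ s t → ¬ LeftWeakStarReducible (WB n) s t w
  not-left {w} ww fc f s t red@(_ , _ , l , _ , _ , ¬fc) with left-factor ww red
  not-left {w} ww fc (commuting {u} cu p) s t red@(_ , _ , l , _ , _ , ¬fc) | v , wv , q , rv =
    commuting-pair (proj₂ cu) (Perm.∈-resp-↭ (∼c⇒↭ c) (here refl)) (Perm.∈-resp-↭ (∼c⇒↭ c) (there (here refl))) l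
    where
    c : s ∷ t ∷ v ∼c u
    c = fc _ _ wv (proj₁ cu) q (≈-sym p) rv (Represented⇒Reduced (CommProd-represented n≥2 cu))
  not-left {w} ww fc (dihedral {p} {q} {u} e cu large h) s t red@(_ , _ , l , _ , _ , ¬fc) | v , wv , h′ , rv =
    go (Perm.∈-resp-↭ (∼c⇒↭ c) (here refl)) (Perm.∈-resp-↭ (∼c⇒↭ c) (there (here refl)))
    where
    c : s ∷ t ∷ v ∼c p ∷ q ∷ u
    c = fc _ _ wv (proj₁ (end-gen e) ∷ proj₂ (end-gen e) ∷ proj₁ cu) h′ (≈-sym h) rv
        (Represented⇒Reduced (end₂-represented e cu large))
    far-end : ∀ {p q s} → Ends p q → s ∈ u → mB s p ≡ 2
    far-end e s∈ = end-far e (All.lookup large s∈)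
    go : s ∈ p ∷ q ∷ u → t ∈ p ∷ q ∷ u → ⊥
    go (here refl) (here refl)                 = ≥3⇒distinct {s} {s} l refl
    go (here refl) (there (here refl))         = ¬fc (FC-resp (≈-sym (∼-∷ q h))
        (Represented⇒FC (end₃-represented (Ends-sym e) cu large)))
    go (here refl) (there (there t∈))          = ≥3⇒≢2 l (trans (mB-sym s t) (far-end e t∈))
    go (there (here refl)) (here refl)         = alt-order {k = 2} [] l (s≤s z≤n) c
    go (there (here refl)) (there (here refl)) = ≥3⇒distinct {s} {s} l refl
    go (there (here refl)) (there (there t∈))  = ≥3⇒≢2 l (trans (mB-sym s t) (far-end (Ends-sym e) t∈))
    go (there (there s∈)) (here refl)          = ≥3⇒≢2 l (far-end e s∈)
    go (there (there s∈)) (there (here refl))  = ≥3⇒≢2 l (far-end (Ends-sym e) s∈)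
    go (there (there s∈)) (there (there t∈))   = commuting-pair (proj₂ cu) s∈ t∈ l

  form⇒nonCancellable : ∀ w → Word (WB n) w → FullyCommutative (WB n) w → Form (WB n) 1 2 3 w → NonCancellable (WB n) w
  form⇒nonCancellable w ww fc f = fc , λ s t →
    not-left ww fc f′ s t
    , λ red → not-left (hom-word (to ι) ww) (iso-FC ι ww fc) (reverse-form f′) s t (reverse-right mB-sym ww red)
    where f′ = form⇒form′ f

-- Relabelling of generators and type B′.

module Relabelling {C D : CoxSys} (φ : ℕ → ℕ)
  (φ-gen : ∀ {s} → Gen C s → Gen D (φ s))
  (φ-m : ∀ {s t} → Gen C s → Gen C t → CoxSys.m D (φ s) (φ t) ≡ CoxSys.m C s t) where
  private
    module C = Coxeter C
    module D = Coxeter D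

    map-alt : ∀ s t k → map φ (alt C s t k) ≡ alt D (φ s) (φ t) k
    map-alt s t zero    = refl
    map-alt s t (suc k) = cong (φ s ∷_) (map-alt t s k)

    map-≈ : ∀ {u v} → u C.∼ v → map φ u D.∼ map φ v
    map-≈ ≈-refl        = ≈-refl
    map-≈ (≈-sym p)     = ≈-sym (map-≈ p)
    map-≈ (≈-trans p q) = ≈-trans (map-≈ p) (map-≈ q)
    map-≈ (≈-cancel {s} u v g) =
      subst₂ D._∼_ (sym (map-++ φ u (s ∷ s ∷ v))) (sym (map-++ φ u v)) (≈-cancel (map φ u) (map φ v) (φ-gen g))
    map-≈ (≈-braid {s} {t} u v g h) =
      subst₂ D._∼_ (side s t) (side t s) (≈-braid (map φ u) (map φ v) (φ-gen g) (φ-gen h))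
      where
      side : ∀ a b → map φ u ++ alt D (φ a) (φ b) (D.m (φ s) (φ t)) ++ map φ v ≡ map φ (u ++ alt C a b (C.m s t) ++ v)
      side a b = trans (cong (λ z → map φ u ++ z ++ map φ v) (trans (cong (alt D (φ a) (φ b)) (φ-m g h))
          (sym (map-alt a b (C.m s t)))))
        (sym (trans (map-++ φ u _) (cong (map φ u ++_) (map-++ φ (alt C a b (C.m s t)) v))))

    map-≈c : ∀ {u v} → Word C u → u C.∼c v → map φ u D.∼c map φ v
    map-≈c w c-refl        = c-refl
    map-≈c w (c-sym p)     = c-sym (map-≈c (C.∼c-Word (c-sym p) w) p)
    map-≈c w (c-trans p q) = c-trans (map-≈c w p) (map-≈c (C.∼c-Word p w) q)
    map-≈c w (c-swap {s} {t} u v e) with All.++⁻ʳ u w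
    ... | g ∷ h ∷ _ = subst₂ D._∼c_ (sym (map-++ φ u (s ∷ t ∷ v))) (sym (map-++ φ u (t ∷ s ∷ v)))
                        (c-swap (map φ u) (map φ v) (trans (φ-m g h) e))

  map-Hom : Hom C D (map φ)
  map-Hom = record
    { hom-word   = λ w → All.map⁺ (All.map φ-gen w)
    ; hom-≈      = map-≈
    ; hom-≈c     = map-≈c
    ; hom-length = length-map φ
    }

  module _ (ι : Iso C D (map φ)) where
    map-left : ∀ {s t w} → Word C w → LeftWeakStarReducible C s t w → LeftWeakStarReducible D (φ s) (φ t) (map φ w)
    map-left ww (gs , gt , l , (_ , _ , h₁ , h₂ , lt) , (_ , _ , h₃ , h₄ , lt′) , ¬fc) =
      φ-gen gs , φ-gen gt , subst (3 ≤_) (sym (φ-m gs gt)) l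
      , (_ , _ , iso-HasLength ι h₁ , iso-HasLength ι h₂ , lt)
      , (_ , _ , iso-HasLength ι h₃ , iso-HasLength ι h₄ , lt′)
      , λ fc → ¬fc (iso-FC⁻ ι (gt ∷ ww) fc)

    map-right : ∀ {s t w} → Word C w → RightWeakStarReducible C s t w → RightWeakStarReducible D (φ s) (φ t) (map φ w)
    map-right {s} {t} {w} ww (gs , gt , l , (_ , _ , h₁ , h₂ , lt) , (_ , _ , h₃ , h₄ , lt′) , ¬fc) =
      φ-gen gs , φ-gen gt , subst (3 ≤_) (sym (φ-m gs gt)) l
      , (_ , _ , ends h₁ , iso-HasLength ι h₂ , lt)
      , (_ , _ , subst (λ z → HasLength D (z ++ [ φ t ]) _) (map-++ φ w [ s ]) (ends h₃) , ends h₄ , lt′)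
      , λ fc → ¬fc (iso-FC⁻ ι (All.++⁺ ww (gt ∷ [])) (subst (FullyCommutative D) (sym (map-++ φ w [ t ])) fc))
      where
      ends : ∀ {x s k} → HasLength C (x ++ [ s ]) k → HasLength D (map φ x ++ [ φ s ]) k
      ends {x} {s} h = subst (λ z → HasLength D z _) (map-++ φ x [ s ]) (iso-HasLength ι h)

    map-CommProd : ∀ {u} → CommProd C u → CommProd D (map φ u)
    map-CommProd (wu , c) = hom-word map-Hom wu , go wu c
      where
      go : ∀ {u} → Word C u → AllPairs (λ a b → C.m a b ≡ 2) u → AllPairs (λ a b → D.m a b ≡ 2) (map φ u)
      go []       []       = []
      go (g ∷ w) (e ∷ es) = All.map⁺ (All.zipWith (λ (h , e) → trans (φ-m g h) e) (w , e)) ∷ go w es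

    map-form : ∀ {a b c w} → φ (φ a) ≡ a → φ (φ b) ≡ b → φ (φ c) ≡ c → Form C a b c w → Form D (φ a) (φ b) (φ c)
        (map φ w)
    map-form ea eb ec (inj₁ (u , cu , p)) = inj₁ (map φ u , map-CommProd cu , map-≈ p)
    map-form {a} {b} {c} {w} ea eb ec (inj₂ f) = inj₂ (pair f)
      where
      avoid : ∀ {s u} → φ (φ s) ≡ s → CommProd C u → ¬ InSupp C s u → ¬ InSupp D (φ s) (map φ u)
      avoid {s} {u} e (wu , _) h h′ = h (subst (InSupp C s) (to-from ι wu)
          (iso-InSupp (Iso-sym ι) (λ s∈ → subst (_∈ _) e (∈-map⁺ φ s∈)) h′))
      pair : _ → _
      pair (inj₁ (u , cu , h₁ , h₂ , h₃ , p)) = inj₁ (map φ u , map-CommProd cu , avoid ea cu h₁ , avoid eb cu h₂ , avoid ec cu h₃ , map-≈ p)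
      pair (inj₂ (u , cu , h₁ , h₂ , h₃ , p)) = inj₂ (map φ u , map-CommProd cu , avoid ea cu h₁ , avoid eb cu h₂ , avoid ec cu h₃ , map-≈ p)

map-involutive : ∀ {φ : ℕ → ℕ} {w} → All (λ s → φ (φ s) ≡ s) w → map φ (map φ w) ≡ w
map-involutive []       = refl
map-involutive (e ∷ es) = cong₂ _∷_ e (map-involutive es)

Form-resp-≡ : ∀ {C a a′ b b′ c c′ w w′} → a ≡ a′ → b ≡ b′ → c ≡ c′ → w ≡ w′ → Form C a b c w → Form C a′ b′ c′ w′
Form-resp-≡ refl refl refl refl f = f

module ClassificationB′ (n : ℕ) (n≥2 : 2 ≤ n) where
  -- Subtraction from 2 + n is an involution on the indices up to 2 + n, which include both sets of
  -- generators. That 1, 2, 3 go to `suc n`, `n`, `n ∸ 1` holds by computation.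
  φ : ℕ → ℕ
  φ i = (2 + n) ∸ i

  φ² : ∀ {i} → i ≤ 2 + n → φ (φ i) ≡ i
  φ² = m∸[m∸n]≡n

  ≡ᵇ-φ : ∀ {i j} → i ≤ 2 + n → j ≤ 2 + n → (φ i ≡ᵇ φ j) ≡ (i ≡ᵇ j)
  ≡ᵇ-φ {i} {j} p q with i ≟ j
  ... | yes refl = trans (dec-true (φ i ≟ φ i) refl) (sym (dec-true (i ≟ i) refl))
  ... | no  i≢j  = trans (dec-false (φ i ≟ φ j) (λ e → i≢j (∸-cancelˡ-≡ p q e))) (sym (dec-false (i ≟ j) i≢j))

  dist-φ : ∀ N {i j} → i ≤ N → j ≤ N → ∣ N ∸ i - N ∸ j ∣ ≡ ∣ i - j ∣
  dist-φ N {zero}  {j} p q = trans (m≤n⇒∣n-m∣≡n∸m (m∸n≤m N j)) (m∸[m∸n]≡n q)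
  dist-φ N {suc i} {zero} p q = trans (m≤n⇒∣m-n∣≡n∸m (m∸n≤m N (suc i))) (m∸[m∸n]≡n p)
  dist-φ (suc N) {suc i} {suc j} (s≤s p) (s≤s q) = dist-φ N p q

  m-φ : ∀ {i j} → i ≤ 2 + n → j ≤ 2 + n → mB' n (φ i) (φ j) ≡ mB i j
  m-φ {i} {j} p q
    -- The tests against `n` and `suc n` are tests against `φ 2` and `φ 1`. They come in the
    -- opposite order to those of `mB`, hence `∨-comm`.
    rewrite ≡ᵇ-φ p q | ≡ᵇ-φ p (s≤s (s≤s (z≤n {n}))) | ≡ᵇ-φ q (s≤s (s≤s (z≤n {n})))
          | ≡ᵇ-φ p (s≤s (z≤n {suc n})) | ≡ᵇ-φ q (s≤s (z≤n {suc n})) | dist-φ (2 + n) p q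
          | ∨-comm ((i ≡ᵇ 2) ∧ (j ≡ᵇ 1)) ((i ≡ᵇ 1) ∧ (j ≡ᵇ 2)) = refl

  small : ∀ {i} → Gen (WB n) i → i ≤ 2 + n
  small (_ , l) = ≤-trans l (≤-trans (n≤1+n _) (n≤1+n _))

  small′ : ∀ {i} → Gen (WB' n) i → i ≤ 2 + n
  small′ (_ , l) = ≤-trans l (n≤1+n _)

  gen : ∀ {i} → Gen (WB n) i → Gen (WB' n) (φ i)
  gen {i} (p , q) = subst (_≤ φ i) (m∸[m∸n]≡n {2 + n} {2} (s≤s (s≤s z≤n))) (∸-monoʳ-≤ (2 + n) q) , ∸-monoʳ-≤ (2 + n) p

  gen′ : ∀ {i} → Gen (WB' n) i → Gen (WB n) (φ i)
  gen′ {i} (p , q) = subst (_≤ φ i) (m∸[m∸n]≡n {2 + n} {1} (s≤s z≤n)) (∸-monoʳ-≤ (2 + n) q) , ∸-monoʳ-≤ (2 + n) p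

  φ≤ : ∀ i → φ i ≤ 2 + n
  φ≤ i = m∸n≤m (2 + n) i

  module To   = Relabelling {WB n} {WB' n} φ gen (λ g h → m-φ (small g) (small h))
  module From = Relabelling {WB' n} {WB n} φ gen′ (λ {s} {t} g h → trans (sym (m-φ (φ≤ s) (φ≤ t)))
      (cong₂ (mB' n) (φ² (small′ g)) (φ² (small′ h))))

  ι : Iso (WB n) (WB' n) (map φ)
  ι = record
    { to      = To.map-Hom
    ; from    = From.map-Hom
    ; to-from = λ w → map-involutive (All.map (λ g → φ² (small g)) w)
    ; from-to = λ w → map-involutive (All.map (λ g → φ² (small′ g)) w)
    }

  open ClassificationB n n≥2

  3≤2+n : 3 ≤ 2 + n
  3≤2+n = s≤s (s≤s (≤-trans (n≤1+n _) n≥2))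

  nonCancellable′⇒form : ∀ w → Word (WB' n) w → FullyCommutative (WB' n) w → NonCancellable (WB' n) w → Form
      (WB' n) (suc n) n (n ∸ 1) w
  nonCancellable′⇒form w ww fc (_ , irr) = Form-resp-≡ refl refl refl (from-to ι ww)
    (To.map-form ι (φ² (s≤s z≤n)) (φ² (s≤s (s≤s z≤n))) (φ² 3≤2+n)
      (nonCancellable⇒form (map φ w) ww′ fc′
        (fc′ , λ s t → (λ red → proj₁ (irr (φ s) (φ t)) (subst (LeftWeakStarReducible (WB' n) (φ s) (φ t))
            (from-to ι ww) (To.map-left ι ww′ red)))
                     , (λ red → proj₂ (irr (φ s) (φ t)) (subst (RightWeakStarReducible (WB' n) (φ s) (φ t))
                         (from-to ι ww) (To.map-right ι ww′ red))))))
    where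
    ww′ = hom-word (from ι) ww
    fc′ = iso-FC (Iso-sym ι) ww fc

  form⇒nonCancellable′ : ∀ w → Word (WB' n) w → FullyCommutative (WB' n) w → Form (WB' n) (suc n) n
      (n ∸ 1) w → NonCancellable (WB' n) w
  form⇒nonCancellable′ w ww fc f = fc , λ s t →
      (λ red → proj₁ (proj₂ nc (φ s) (φ t)) (From.map-left (Iso-sym ι) ww red))
    , (λ red → proj₂ (proj₂ nc (φ s) (φ t)) (From.map-right (Iso-sym ι) ww red))
    where
    f′ : Form (WB n) 1 2 3 (map φ w)
    f′ = Form-resp-≡ (φ² {1} (s≤s z≤n)) (φ² {2} (s≤s (s≤s z≤n))) (φ² {3} 3≤2+n) refl
      (From.map-form (Iso-sym ι) (φ² (φ≤ 1)) (φ² (φ≤ 2)) (φ² (φ≤ 3)) f)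
    nc : NonCancellable (WB n) (map φ w)
    nc = form⇒nonCancellable (map φ w) (hom-word (from ι) ww) (iso-FC (Iso-sym ι) ww fc) f′

theorem4p4 : (n : ℕ) → 2 ≤ n →
    ((w : List ℕ) → Word (WB n) w → FullyCommutative (WB n) w →
    (NonCancellable (WB n) w →
    (Σ (List ℕ) λ u → CommProd (WB n) u × _≈_ (WB n) w u)
    ⊎ (Σ (List ℕ) λ u → CommProd (WB n) u × ¬ InSupp (WB n) 1 u × ¬ InSupp (WB n) 2 u
    × ¬ InSupp (WB n) 3 u × _≈_ (WB n) w (1 ∷ 2 ∷ u))
    ⊎ (Σ (List ℕ) λ u → CommProd (WB n) u × ¬ InSupp (WB n) 1 u × ¬ InSupp (WB n) 2 u
    × ¬ InSupp (WB n) 3 u × _≈_ (WB n) w (2 ∷ 1 ∷ u)))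
    × ((  (Σ (List ℕ) λ u → CommProd (WB n) u × _≈_ (WB n) w u)
    ⊎ (Σ (List ℕ) λ u → CommProd (WB n) u × ¬ InSupp (WB n) 1 u × ¬ InSupp (WB n) 2 u
    × ¬ InSupp (WB n) 3 u × _≈_ (WB n) w (1 ∷ 2 ∷ u))
    ⊎ (Σ (List ℕ) λ u → CommProd (WB n) u × ¬ InSupp (WB n) 1 u × ¬ InSupp (WB n) 2 u
    × ¬ InSupp (WB n) 3 u × _≈_ (WB n) w (2 ∷ 1 ∷ u)))
    → NonCancellable (WB n) w))
    ×
    ((w : List ℕ) → Word (WB' n) w → FullyCommutative (WB' n) w →
    (NonCancellable (WB' n) w →
    (Σ (List ℕ) λ u → CommProd (WB' n) u × _≈_ (WB' n) w u)
    ⊎ (Σ (List ℕ) λ u → CommProd (WB' n) u × ¬ InSupp (WB' n) (suc n) u × ¬ InSupp (WB' n) n u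
    × ¬ InSupp (WB' n) (n ∸ 1) u × _≈_ (WB' n) w (suc n ∷ n ∷ u))
    ⊎ (Σ (List ℕ) λ u → CommProd (WB' n) u × ¬ InSupp (WB' n) (suc n) u × ¬ InSupp (WB' n) n u
    × ¬ InSupp (WB' n) (n ∸ 1) u × _≈_ (WB' n) w (n ∷ suc n ∷ u)))
    × ((  (Σ (List ℕ) λ u → CommProd (WB' n) u × _≈_ (WB' n) w u)
    ⊎ (Σ (List ℕ) λ u → CommProd (WB' n) u × ¬ InSupp (WB' n) (suc n) u × ¬ InSupp (WB' n) n u
    × ¬ InSupp (WB' n) (n ∸ 1) u × _≈_ (WB' n) w (suc n ∷ n ∷ u))
    ⊎ (Σ (List ℕ) λ u → CommProd (WB' n) u × ¬ InSupp (WB' n) (suc n) u × ¬ InSupp (WB' n) n u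
    × ¬ InSupp (WB' n) (n ∸ 1) u × _≈_ (WB' n) w (n ∷ suc n ∷ u)))
    → NonCancellable (WB' n) w))
theorem4p4 n n≥2 =
    (λ w ww fc → nonCancellable⇒form w ww fc , form⇒nonCancellable w ww fc)
  , (λ w ww fc → nonCancellable′⇒form w ww fc , form⇒nonCancellable′ w ww fc)
  where
  open ClassificationB n n≥2
  open ClassificationB′ n n≥2
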